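{- Let $\mathbb{F}_2((x))$ be the field of formal Laurent series over $\mathbb{F}_2$. Take a sequence $\{x^{1/n}\}_{n\in\mathbb{Z}_{>0}}$ of elements of an algebraic closure of $\mathbb{F}_2((x))$ such that $x^{1/1}=x$ and $(x^{1/mn})^m=x^{1/n}$ for all $m,n\in\mathbb{Z}_{>0}$. Let \[L_0:=\bigcup_{n=1}^{\infty}\mathbb{F}_2((x))(x^{1/n})=\bigcup_{n=1}^{\infty}\mathbb{F}_2((x^{1/n})).\] Then the multiplicative group $L_0^{\times}$ is a linear space over $\mathbb{Q}$.
   Context: An abelian group $G$ (written multiplicatively) is said to be a linear space over a field $K$ if there is a scalar multiplication $K\times G\to G$ making $G$, with its group operation as vector addition, a vector space over $K$. -}

module Defs where

open import Data.Bool using (Bool; true; false; _xor_; _∧_)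
open import Data.Nat as ℕ using (ℕ; zero; suc; _∸_)
open import Data.Nat.DivMod using (_%_; _/_)
open import Data.Integer as ℤ using (ℤ; +_; -[1+_])
open import Data.Rational as ℚ using (ℚ)
open import Data.Product using (Σ; proj₁)
open import Relation.Binary.PropositionalEquality using (_≡_)

-- The field F₂ is modelled by Bool with addition _xor_ and multiplication _∧_.

-- A formal Laurent series over F₂ in a variable t:
--   Σ_{k ≥ 0} coeff k · t^(val + k)
record Laurent : Set where
  constructor laurent
  field
    val   : ℤ
    coeff : ℕ → Bool
open Laurent public

coefAt : Laurent → ℤ → Bool
coefAt f e with e ℤ.- val f
... | + k      = coeff f k
... | -[1+ _ ] = false

sumTo : (ℕ → Bool) → ℕ → Bool
sumTo h zero    = h zero
sumTo h (suc k) = sumTo h k xor h (suc k)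

_*L_ : Laurent → Laurent → Laurent
f *L g = laurent (val f ℤ.+ val g)
                 (λ k → sumTo (λ i → coeff f i ∧ coeff g (k ∸ i)) k)

-- substitution t ↦ s^(suc m): a series in t regarded as a series in s
scaleL : ℕ → Laurent → Laurent
scaleL m f = laurent ((+ suc m) ℤ.* val f) c
  where
  c : ℕ → Bool
  c k with k % suc m
  ... | zero  = coeff f (k / suc m)
  ... | suc _ = false

-- An element of L₀ = ⋃ₙ F₂((x^{1/n})): a Laurent series in x^{1/(suc d)}.
record L0 : Set where
  constructor puiseux
  field
    d   : ℕ        -- the denominator is n = suc d
    ser : Laurent  -- the element  Σ_e coefAt ser e · x^(e / n)
open L0 public

coefQ : L0 → ℚ → Bool
coefQ a q with ℚ.denominator-1 r
  where r = q ℚ.* ((+ suc (d a)) ℚ./ 1)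
... | zero  = coefAt (ser a) (ℚ.numerator (q ℚ.* ((+ suc (d a)) ℚ./ 1)))
... | suc _ = false

-- equality in L₀ (independent of the chosen denominator)
_≈_ : L0 → L0 → Set
a ≈ b = ∀ q → coefQ a q ≡ coefQ b q

-- multiplication in L₀ (via the common denominator (suc d₁)(suc d₂))
_*_ : L0 → L0 → L0
puiseux d₁ f * puiseux d₂ g =
  puiseux (d₂ ℕ.+ d₁ ℕ.* suc d₂) (scaleL d₂ f *L scaleL d₁ g)

one : L0
one = puiseux 0 (laurent (+ 0) λ { zero → true ; (suc _) → false })

Unit : Set
Unit = Σ L0 λ a → Σ L0 λ b → (a * b) ≈ one

elt : Unit → L0
elt = proj₁

record QLinearSpace : Set where
  field
    _·_      : ℚ → Unit → Unit
    ·-cong   : ∀ q u v → elt u ≈ elt v → elt (q · u) ≈ elt (q · v)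
    ·-distˡ  : ∀ q u v w → elt w ≈ (elt u * elt v) →
               elt (q · w) ≈ (elt (q · u) * elt (q · v))
    ·-distʳ  : ∀ p q u → elt ((p ℚ.+ q) · u) ≈ (elt (p · u) * elt (q · u))
    ·-assoc  : ∀ p q u → elt ((p ℚ.* q) · u) ≈ elt (p · (q · u))
    ·-identity : ∀ u → elt (ℚ.1ℚ · u) ≈ elt u

{-# OPTIONS --safe #-}
-- A uniquely divisible abelian group is a ℚ-vector space, so it suffices to show that every
-- unit of L₀ has exactly one n-th root for each n ≥ 1, and only n = 2 and odd n matter.
-- In characteristic 2 squaring is the substitution t ↦ t²; read with the denominator doubled,
-- the same series is therefore the square root.  For odd n write the unit as x^(v/D) · g(t) with
-- t = x^(1/D) and g = 1 + …; the monomial is divided by enlarging the denominator, and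
-- the root h of g is found coefficient by coefficient, since the k-th coefficient of hⁿ is
-- n · h_k = h_k plus an expression in the earlier coefficients of h.
module Submission where

open import Algebra.Bundles using (AbelianGroup; CommutativeMonoid)
import Algebra.Properties.AbelianGroup as AbelianGroupProperties
import Algebra.Properties.CommutativeMonoid.Mult as Mult
import Algebra.Properties.CommutativeSemigroup as CommutativeSemigroupProperties
open import Algebra.Solver.Ring.AlmostCommutativeRing using (fromCommutativeRing)
import Algebra.Solver.Ring.Simple as RingSolver
open import Data.Bool using (Bool; true; false; not; _xor_; _∧_)
import Data.Bool.Properties as Boolₚ
open import Data.Integer as ℤ using (ℤ; +_; -[1+_])
import Data.Integer.Properties as ℤₚ
open import Data.Integer.Tactic.RingSolver using (solve-∀)
open import Data.Nat as ℕ using (ℕ; zero; suc; _∸_; _≤_; _<_; z≤n; s≤s)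
import Data.Nat.Coprimality as Coprimality
open import Data.Nat.DivMod as DivMod using (_%_; _/_)
open import Data.Nat.Induction using (<-rec)
import Data.Nat.Properties as ℕₚ
open import Data.Product using (Σ; ∃; _×_; _,_; proj₁; proj₂)
open import Data.Rational as ℚ using (ℚ; mkℚ)
import Data.Rational.Properties as ℚₚ
open import Data.Rational.Unnormalised as ℚᵘ using (ℚᵘ; *≡*)
import Data.Rational.Unnormalised.Properties as ℚᵘₚ
open import Function using (_∘_)
open import Level using (0ℓ; _⊔_)
open import Relation.Binary.Bundles using (Setoid)
open import Relation.Binary.PropositionalEquality as ≡ using (_≡_)
import Relation.Binary.Reasoning.Setoid as SetoidReasoning
open import Relation.Nullary using (¬_; yes; no)

open import Defs

-- Uniquely divisible abelian groups

-- Uniqueness of roots rests on the residue field: 1 is the only nonzero element of F₂, so there is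
-- no leading coefficient to take a root of and no nontrivial root of unity to multiply by. The
-- split into 2 and odd `n` is forced: for even `n` the term n · h_k vanishes, and the coefficient
-- recursion determines nothing.
--
-- Two obstacles shape the rest. An element has many representations, since a Laurent series may
-- begin with zeros and a denominator may be replaced by any multiple. Products are defined on
-- representations, so padding (`lower`) and change of denominator (`rescale`) are needed to see
-- that they respect `_≈_`; after that, `*-represent` reduces each law of `L0` to Laurent series
-- over one denominator. Moreover, a function `ℕ → Bool` does not reveal whether it is zero, so a
-- leading term has to be extracted from the inverse that a unit carries.

odd : ℕ → Bool
odd zero    = false
odd (suc n) = not (odd n)

even-half : ∀ n → odd n ≡ false → ∃ λ k → n ≡ k ℕ.* 2
even-half zero          _ = 0 , ≡.refl
even-half (suc (suc n)) e =
  let k , n≡ = even-half n (≡.trans (≡.sym (Boolₚ.not-involutive (odd n))) e)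
  in suc k , ≡.cong (suc ∘ suc) n≡

module Divisibility {c ℓ} (M : CommutativeMonoid c ℓ) where
  open CommutativeMonoid M renaming (_≈_ to _≋_)
  open Mult M renaming (_×_ to _⊙_)

  UniquelyDivisibleBy : ℕ → Set (c ⊔ ℓ)
  UniquelyDivisibleBy n =
    (∀ x y → n ⊙ x ≋ n ⊙ y → x ≋ y) × (∀ x → Σ Carrier λ y → n ⊙ y ≋ x)

  divisible-* : ∀ m n → UniquelyDivisibleBy m → UniquelyDivisibleBy n → UniquelyDivisibleBy (m ℕ.* n)
  divisible-* m n (injₘ , divₘ) (injₙ , divₙ) =
    (λ x y eq → injₙ x y (injₘ _ _ (trans (×-assocˡ x m n) (trans eq (sym (×-assocˡ y m n)))))) ,
    (λ x → let y , my≋x = divₘ x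
               z , nz≋y = divₙ y
           in z , trans (sym (×-assocˡ z m n)) (trans (×-congʳ m nz≋y) my≋x))

  divisible-all : UniquelyDivisibleBy 2 → (∀ n → odd n ≡ true → UniquelyDivisibleBy n) →
                  ∀ n → UniquelyDivisibleBy (suc n)
  divisible-all by-2 by-odd = <-rec _ step
    where
    step : ∀ n → (∀ {m} → m < n → UniquelyDivisibleBy (suc m)) → UniquelyDivisibleBy (suc n)
    step n rec with odd (suc n) in parity
    ... | true  = by-odd (suc n) parity
    ... | false with even-half (suc n) parity
    -- Here `n` is `suc (k * 2)`, so the descent to `k` asks only for `k ≤ k * 2`.
    ...   | suc k , ≡.refl = divisible-* (suc k) 2 (rec (s≤s (ℕₚ.m≤m*n k 2))) by-2

-- Integer exponents in an abelian group

module IntegerPowers {c ℓ} (G : AbelianGroup c ℓ) where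
  open AbelianGroup G renaming (_≈_ to _≋_)
  open AbelianGroupProperties G
  open Mult commutativeMonoid renaming (_×_ to _⊙_)
  open CommutativeSemigroupProperties commutativeSemigroup using (interchange)
  open SetoidReasoning setoid

  infixr 8 _⊡_

  _⊡_ : ℤ → Carrier → Carrier
  (+ n)    ⊡ x = n ⊙ x
  -[1+ n ] ⊡ x = (suc n ⊙ x) ⁻¹

  ⊡-cong : ∀ p {x y} → x ≋ y → p ⊡ x ≋ p ⊡ y
  ⊡-cong (+ n)    x≋y = ×-congʳ n x≋y
  ⊡-cong -[1+ n ] x≋y = ⁻¹-cong (×-congʳ (suc n) x≋y)

  ⊡-distrib-∙ : ∀ p x y → p ⊡ (x ∙ y) ≋ p ⊡ x ∙ p ⊡ y
  ⊡-distrib-∙ (+ n)    x y = ×-distrib-+ x y n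
  ⊡-distrib-∙ -[1+ n ] x y = begin
    (suc n ⊙ (x ∙ y)) ⁻¹            ≈⟨ ⁻¹-cong (×-distrib-+ x y (suc n)) ⟩
    (suc n ⊙ x ∙ suc n ⊙ y) ⁻¹      ≈⟨ ⁻¹-∙-comm _ _ ⟨
    (suc n ⊙ x) ⁻¹ ∙ (suc n ⊙ y) ⁻¹ ∎

  -- Addition of integers of opposite sign is defined through `_⊖_`, so this settles the mixed cases
  -- of `⊡-homo-+`. Inserting `x ∙ x ⁻¹` raises both exponents by one.
  ⊡-homo-⊖ : ∀ m n x → (m ℤ.⊖ n) ⊡ x ≋ m ⊙ x ∙ (n ⊙ x) ⁻¹
  ⊡-homo-⊖ zero    zero    x = sym (inverseʳ ε)
  ⊡-homo-⊖ zero    (suc n) x = sym (identityˡ _)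
  ⊡-homo-⊖ (suc m) zero    x = sym (trans (∙-congˡ ε⁻¹≈ε) (identityʳ _))
  ⊡-homo-⊖ (suc m) (suc n) x = begin
    (suc m ℤ.⊖ suc n) ⊡ x               ≡⟨ ≡.cong (_⊡ x) (ℤₚ.[1+m]⊖[1+n]≡m⊖n m n) ⟩
    (m ℤ.⊖ n) ⊡ x                       ≈⟨ ⊡-homo-⊖ m n x ⟩
    m ⊙ x ∙ (n ⊙ x) ⁻¹                  ≈⟨ identityˡ _ ⟨
    ε ∙ (m ⊙ x ∙ (n ⊙ x) ⁻¹)            ≈⟨ ∙-congʳ (inverseʳ x) ⟨
    (x ∙ x ⁻¹) ∙ (m ⊙ x ∙ (n ⊙ x) ⁻¹)   ≈⟨ interchange _ _ _ _ ⟩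
    (x ∙ m ⊙ x) ∙ (x ⁻¹ ∙ (n ⊙ x) ⁻¹)   ≈⟨ ∙-congˡ (⁻¹-∙-comm _ _) ⟩
    suc m ⊙ x ∙ (suc n ⊙ x) ⁻¹          ∎

  ⊡-homo-+ : ∀ p q x → (p ℤ.+ q) ⊡ x ≋ p ⊡ x ∙ q ⊡ x
  ⊡-homo-+ (+ m)    (+ n)    x = ×-homo-+ x m n
  ⊡-homo-+ (+ m)    -[1+ n ] x = ⊡-homo-⊖ m (suc n) x
  ⊡-homo-+ -[1+ m ] (+ n)    x = trans (⊡-homo-⊖ n (suc m) x) (comm _ _)
  ⊡-homo-+ -[1+ m ] -[1+ n ] x = begin
    (suc (suc (m ℕ.+ n)) ⊙ x) ⁻¹    ≡⟨ ≡.cong (λ k → (suc k ⊙ x) ⁻¹) (ℕₚ.+-suc m n) ⟨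
    ((suc m ℕ.+ suc n) ⊙ x) ⁻¹      ≈⟨ ⁻¹-cong (×-homo-+ x (suc m) (suc n)) ⟩
    (suc m ⊙ x ∙ suc n ⊙ x) ⁻¹      ≈⟨ ⁻¹-∙-comm _ _ ⟨
    (suc m ⊙ x) ⁻¹ ∙ (suc n ⊙ x) ⁻¹ ∎

  ⊡-homo-neg : ∀ p x → (ℤ.- p) ⊡ x ≋ (p ⊡ x) ⁻¹
  ⊡-homo-neg (+ zero)  x = sym ε⁻¹≈ε
  ⊡-homo-neg (+ suc n) x = refl
  ⊡-homo-neg -[1+ n ]  x = sym (⁻¹-involutive _)

  ⊡-homo-+* : ∀ n q x → ((+ n) ℤ.* q) ⊡ x ≋ n ⊙ (q ⊡ x)
  ⊡-homo-+* zero    q x = refl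
  ⊡-homo-+* (suc n) q x = begin
    ((+ suc n) ℤ.* q) ⊡ x       ≡⟨ ≡.cong (_⊡ x) (ℤₚ.suc-* (+ n) q) ⟩
    (q ℤ.+ (+ n) ℤ.* q) ⊡ x     ≈⟨ ⊡-homo-+ q _ x ⟩
    q ⊡ x ∙ ((+ n) ℤ.* q) ⊡ x   ≈⟨ ∙-congˡ (⊡-homo-+* n q x) ⟩
    suc n ⊙ (q ⊡ x)             ∎

  ⊡-homo-* : ∀ p q x → (p ℤ.* q) ⊡ x ≋ p ⊡ (q ⊡ x)
  ⊡-homo-* (+ n)    q x = ⊡-homo-+* n q x
  ⊡-homo-* -[1+ n ] q x = begin
    (-[1+ n ] ℤ.* q) ⊡ x            ≡⟨ ≡.cong (_⊡ x) (ℤₚ.neg-distribˡ-* (+ suc n) q) ⟨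
    (ℤ.- ((+ suc n) ℤ.* q)) ⊡ x     ≈⟨ ⊡-homo-neg ((+ suc n) ℤ.* q) x ⟩
    (((+ suc n) ℤ.* q) ⊡ x) ⁻¹      ≈⟨ ⁻¹-cong (⊡-homo-+* (suc n) q x) ⟩
    -[1+ n ] ⊡ (q ⊡ x)              ∎

  ⊡-comm : ∀ p q x → p ⊡ (q ⊡ x) ≋ q ⊡ (p ⊡ x)
  ⊡-comm p q x = begin
    p ⊡ (q ⊡ x)   ≈⟨ ⊡-homo-* p q x ⟨
    (p ℤ.* q) ⊡ x ≡⟨ ≡.cong (_⊡ x) (ℤₚ.*-comm p q) ⟩
    (q ℤ.* p) ⊡ x ≈⟨ ⊡-homo-* q p x ⟩
    q ⊡ (p ⊡ x)   ∎

-- Rational exponents in a uniquely divisible group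

module UniquelyDivisible {c ℓ} (G : AbelianGroup c ℓ)
  (divisible : ∀ n → Divisibility.UniquelyDivisibleBy (AbelianGroup.commutativeMonoid G) (suc n))
  where

  open AbelianGroup G renaming (_≈_ to _≋_)
  open IntegerPowers G
  open SetoidReasoning setoid

  infixr 8 _•_

  _•_ : ℚ → Carrier → Carrier
  q • x = proj₁ (proj₂ (divisible (ℚ.denominator-1 q)) (ℚ.↥ q ⊡ x))

  •-spec : ∀ q x → (ℚ.↧ q) ⊡ (q • x) ≋ ℚ.↥ q ⊡ x
  •-spec q x = proj₂ (proj₂ (divisible (ℚ.denominator-1 q)) (ℚ.↥ q ⊡ x))

  -- The exponent laws produce unreduced fractions, whereas sums and products in `ℚ` are normalised;
  -- this lets `q • x` be recognised from any fraction `s` equal to `q`. Both candidates agree after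
  -- raising to `↧s` and then to `↧q`, by cross multiplication, and divisibility by each is
  -- injective.
  •-unique : ∀ q s {x y} → ℚᵘ.↧ s ⊡ y ≋ ℚᵘ.↥ s ⊡ x → ℚ.toℚᵘ q ℚᵘ.≃ s → q • x ≋ y
  •-unique q@record{} s {x} {y} ↧sy≋↥sx (*≡* eq) =
    proj₁ (divisible (ℚᵘ.denominator-1 s)) _ _ (proj₁ (divisible (ℚ.denominator-1 q)) _ _ (begin
      ↧q ⊡ ↧s ⊡ q • x   ≈⟨ ⊡-comm ↧q ↧s _ ⟩
      ↧s ⊡ ↧q ⊡ q • x   ≈⟨ ⊡-cong ↧s (•-spec q x) ⟩
      ↧s ⊡ ↥q ⊡ x       ≈⟨ ⊡-comm ↧s ↥q x ⟩
      ↥q ⊡ ↧s ⊡ x       ≈⟨ ⊡-homo-* ↥q ↧s x ⟨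
      (↥q ℤ.* ↧s) ⊡ x   ≡⟨ ≡.cong (_⊡ x) eq ⟩
      (↥s ℤ.* ↧q) ⊡ x   ≈⟨ ⊡-homo-* ↥s ↧q x ⟩
      ↥s ⊡ ↧q ⊡ x       ≈⟨ ⊡-comm ↥s ↧q x ⟩
      ↧q ⊡ ↥s ⊡ x       ≈⟨ ⊡-cong ↧q ↧sy≋↥sx ⟨
      ↧q ⊡ ↧s ⊡ y       ∎))
    where
    ↥q = ℚ.↥ q
    ↧q = ℚ.↧ q
    ↥s = ℚᵘ.↥ s
    ↧s = ℚᵘ.↧ s

  •-cong : ∀ q {x y} → x ≋ y → q • x ≋ q • y
  •-cong q@record{} {x} {y} x≋y = •-unique q (ℚ.toℚᵘ q)
    (trans (•-spec q y) (⊡-cong (ℚ.↥ q) (sym x≋y))) ℚᵘₚ.≃-refl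

  •-distrib-∙ : ∀ q x y → q • (x ∙ y) ≋ q • x ∙ q • y
  •-distrib-∙ q@record{} x y = •-unique q (ℚ.toℚᵘ q) (begin
    (ℚ.↧ q) ⊡ (q • x ∙ q • y)             ≈⟨ ⊡-distrib-∙ (ℚ.↧ q) _ _ ⟩
    (ℚ.↧ q) ⊡ q • x ∙ (ℚ.↧ q) ⊡ q • y   ≈⟨ ∙-cong (•-spec q x) (•-spec q y) ⟩
    ℚ.↥ q ⊡ x ∙ ℚ.↥ q ⊡ y             ≈⟨ ⊡-distrib-∙ (ℚ.↥ q) x y ⟨
    ℚ.↥ q ⊡ (x ∙ y)                     ∎) ℚᵘₚ.≃-refl

  •-homo-+ : ∀ p q x → (p ℚ.+ q) • x ≋ p • x ∙ q • x
  •-homo-+ p@record{} q@record{} x = •-unique (p ℚ.+ q) (ℚ.toℚᵘ p ℚᵘ.+ ℚ.toℚᵘ q) (begin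
    (↧p ℤ.* ↧q) ⊡ (p • x ∙ q • x)
      ≈⟨ ⊡-distrib-∙ (↧p ℤ.* ↧q) _ _ ⟩
    (↧p ℤ.* ↧q) ⊡ p • x ∙ (↧p ℤ.* ↧q) ⊡ q • x
      ≈⟨ ∙-cong (trans (⊡-homo-* ↧p ↧q _) (⊡-comm ↧p ↧q _)) (⊡-homo-* ↧p ↧q _) ⟩
    ↧q ⊡ ↧p ⊡ p • x ∙ ↧p ⊡ ↧q ⊡ q • x
      ≈⟨ ∙-cong (⊡-cong ↧q (•-spec p x)) (⊡-cong ↧p (•-spec q x)) ⟩
    ↧q ⊡ ↥p ⊡ x ∙ ↧p ⊡ ↥q ⊡ x
      ≈⟨ ∙-cong (trans (⊡-comm ↧q ↥p x) (sym (⊡-homo-* ↥p ↧q x)))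
                (trans (⊡-comm ↧p ↥q x) (sym (⊡-homo-* ↥q ↧p x))) ⟩
    (↥p ℤ.* ↧q) ⊡ x ∙ (↥q ℤ.* ↧p) ⊡ x
      ≈⟨ ⊡-homo-+ (↥p ℤ.* ↧q) (↥q ℤ.* ↧p) x ⟨
    (↥p ℤ.* ↧q ℤ.+ ↥q ℤ.* ↧p) ⊡ x ∎)
    (ℚₚ.toℚᵘ-homo-+ p q)
    where
    ↥p = ℚ.↥ p
    ↧p = ℚ.↧ p
    ↥q = ℚ.↥ q
    ↧q = ℚ.↧ q

  •-homo-* : ∀ p q x → (p ℚ.* q) • x ≋ p • (q • x)
  •-homo-* p@record{} q@record{} x = •-unique (p ℚ.* q) (ℚ.toℚᵘ p ℚᵘ.* ℚ.toℚᵘ q) (begin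
    (↧p ℤ.* ↧q) ⊡ p • q • x  ≈⟨ ⊡-homo-* ↧p ↧q _ ⟩
    ↧p ⊡ ↧q ⊡ p • q • x      ≈⟨ ⊡-comm ↧p ↧q _ ⟩
    ↧q ⊡ ↧p ⊡ p • q • x      ≈⟨ ⊡-cong ↧q (•-spec p _) ⟩
    ↧q ⊡ ↥p ⊡ q • x          ≈⟨ ⊡-comm ↧q ↥p _ ⟩
    ↥p ⊡ ↧q ⊡ q • x          ≈⟨ ⊡-cong ↥p (•-spec q x) ⟩
    ↥p ⊡ ↥q ⊡ x              ≈⟨ ⊡-homo-* ↥p ↥q x ⟨
    (↥p ℤ.* ↥q) ⊡ x          ∎)
    (ℚₚ.toℚᵘ-homo-* p q)
    where
    ↥p = ℚ.↥ p
    ↧p = ℚ.↧ p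
    ↥q = ℚ.↥ q
    ↧q = ℚ.↧ q

  •-identity : ∀ x → ℚ.1ℚ • x ≋ x
  •-identity x = •-unique ℚ.1ℚ (ℚ.toℚᵘ ℚ.1ℚ) refl ℚᵘₚ.≃-refl

-- The solver takes its coefficients in F₂ itself, so it also proves identities that depend on
-- `1 + 1 = 0`.
module F₂ = RingSolver (fromCommutativeRing Boolₚ.xor-∧-commutativeRing) Boolₚ._≟_
open F₂ using (_:+_; _:*_; _:=_; con)

-- Power series over F₂

Series : Set
Series = ℕ → Bool

infix 4 _≐_
infixl 6 _⊕_
infixl 7 _⊛_

_≐_ : Series → Series → Set
f ≐ g = ∀ k → f k ≡ g k

δ : Series
δ zero    = true
δ (suc _) = false

_⊕_ : Series → Series → Series
(f ⊕ g) k = f k xor g k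

_⊛_ : Series → Series → Series
(f ⊛ g) k = sumTo (λ i → f i ∧ g (k ∸ i)) k

shift : Series → Series
shift f zero    = false
shift f (suc k) = f k

shifts : ℕ → Series → Series
shifts zero    f = f
shifts (suc m) f = shift (shifts m f)

sumTo-cong : ∀ {g h} k → (∀ i → i ≤ k → g i ≡ h i) → sumTo g k ≡ sumTo h k
sumTo-cong zero    eq = eq 0 z≤n
sumTo-cong (suc k) eq =
  ≡.cong₂ _xor_ (sumTo-cong k λ i i≤k → eq i (ℕₚ.m≤n⇒m≤1+n i≤k)) (eq (suc k) ℕₚ.≤-refl)

sumTo-suc : ∀ h k → sumTo h (suc k) ≡ h 0 xor sumTo (h ∘ suc) k
sumTo-suc h zero    = ≡.refl
sumTo-suc h (suc k) =
  ≡.trans (≡.cong (_xor h (suc (suc k))) (sumTo-suc h k)) (Boolₚ.xor-assoc (h 0) _ _)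

sumTo-true : ∀ h k → sumTo h k ≡ true → ∃ λ i → h i ≡ true
sumTo-true h zero    eq = 0 , eq
sumTo-true h (suc k) eq with h (suc k) in hk
... | true  = suc k , hk
... | false = sumTo-true h k (≡.trans (≡.sym (Boolₚ.xor-identityʳ _)) eq)

⊛-cong : ∀ {f f′ g g′} → f ≐ f′ → g ≐ g′ → f ⊛ g ≐ f′ ⊛ g′
⊛-cong f≐f′ g≐g′ k = sumTo-cong k λ i _ → ≡.cong₂ _∧_ (f≐f′ i) (g≐g′ (k ∸ i))

-- With `f ∘ suc` read as `(f - f 0) / t`, this and `⊛-sucʳ` split off the constant term of one
-- factor. They turn facts about Cauchy products into inductions on the exponent.
⊛-sucˡ : ∀ f g k → (f ⊛ g) (suc k) ≡ (f 0 ∧ g (suc k)) xor ((f ∘ suc) ⊛ g) k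
⊛-sucˡ f g k = sumTo-suc (λ i → f i ∧ g (suc k ∸ i)) k

⊛-sucʳ : ∀ f g k → (f ⊛ g) (suc k) ≡ (f ⊛ (g ∘ suc)) k xor (f (suc k) ∧ g 0)
⊛-sucʳ f g k = ≡.cong₂ _xor_
  (sumTo-cong k λ i i≤k → ≡.cong (λ j → f i ∧ g j) (ℕₚ.+-∸-assoc 1 i≤k))
  (≡.cong (λ j → f (suc k) ∧ g j) (ℕₚ.n∸n≡0 k))

-- Splitting the first term off one product and the last off the other leaves the same claim for
-- `f ∘ suc` and `g`, which avoids reversing the sum.
⊛-comm : ∀ f g → f ⊛ g ≐ g ⊛ f
⊛-comm f g zero    = Boolₚ.∧-comm (f 0) (g 0)
⊛-comm f g (suc k) = begin
  (f ⊛ g) (suc k)                              ≡⟨ ⊛-sucˡ f g k ⟩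
  (f 0 ∧ g (suc k)) xor ((f ∘ suc) ⊛ g) k      ≡⟨ ≡.cong ((f 0 ∧ g (suc k)) xor_) (⊛-comm (f ∘ suc) g k) ⟩
  (f 0 ∧ g (suc k)) xor (g ⊛ (f ∘ suc)) k      ≡⟨ F₂.solve 3 (λ a b c → a :* b :+ c := c :+ b :* a) ≡.refl (f 0) (g (suc k)) _ ⟩
  (g ⊛ (f ∘ suc)) k xor (g (suc k) ∧ f 0)      ≡⟨ ⊛-sucʳ g f k ⟨
  (g ⊛ f) (suc k)                              ∎
  where open ≡.≡-Reasoning

⊛-distribʳ-⊕ : ∀ f g h → (f ⊕ g) ⊛ h ≐ (f ⊛ h) ⊕ (g ⊛ h)
⊛-distribʳ-⊕ f g h zero    = Boolₚ.∧-distribʳ-xor (h 0) (f 0) (g 0)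
⊛-distribʳ-⊕ f g h (suc k) = begin
  ((f ⊕ g) ⊛ h) (suc k)
    ≡⟨ ⊛-sucˡ (f ⊕ g) h k ⟩
  ((f 0 xor g 0) ∧ h (suc k)) xor (((f ⊕ g) ∘ suc) ⊛ h) k
    ≡⟨ ≡.cong (((f 0 xor g 0) ∧ h (suc k)) xor_) (⊛-distribʳ-⊕ (f ∘ suc) (g ∘ suc) h k) ⟩
  ((f 0 xor g 0) ∧ h (suc k)) xor (((f ∘ suc) ⊛ h) k xor ((g ∘ suc) ⊛ h) k)
    ≡⟨ F₂.solve 5 (λ a b c x y → (a :+ b) :* c :+ (x :+ y) := (a :* c :+ x) :+ (b :* c :+ y)) ≡.refl (f 0) (g 0) (h (suc k)) _ _ ⟩
  ((f 0 ∧ h (suc k)) xor ((f ∘ suc) ⊛ h) k) xor ((g 0 ∧ h (suc k)) xor ((g ∘ suc) ⊛ h) k)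
    ≡⟨ ≡.cong₂ _xor_ (⊛-sucˡ f h k) (⊛-sucˡ g h k) ⟨
  ((f ⊛ h) ⊕ (g ⊛ h)) (suc k) ∎
  where open ≡.≡-Reasoning

⊛-distribˡ-⊕ : ∀ f g h → f ⊛ (g ⊕ h) ≐ (f ⊛ g) ⊕ (f ⊛ h)
⊛-distribˡ-⊕ f g h k = begin
  (f ⊛ (g ⊕ h)) k        ≡⟨ ⊛-comm f (g ⊕ h) k ⟩
  ((g ⊕ h) ⊛ f) k        ≡⟨ ⊛-distribʳ-⊕ g h f k ⟩
  ((g ⊛ f) ⊕ (h ⊛ f)) k  ≡⟨ ≡.cong₂ _xor_ (⊛-comm g f k) (⊛-comm h f k) ⟩
  ((f ⊛ g) ⊕ (f ⊛ h)) k  ∎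
  where open ≡.≡-Reasoning

infixr 7 _∧ₛ_

_∧ₛ_ : Bool → Series → Series
(b ∧ₛ f) k = b ∧ f k

⊛-scalarˡ : ∀ b f g → (b ∧ₛ f) ⊛ g ≐ b ∧ₛ (f ⊛ g)
⊛-scalarˡ b f g zero    = Boolₚ.∧-assoc b (f 0) (g 0)
⊛-scalarˡ b f g (suc k) = begin
  ((b ∧ₛ f) ⊛ g) (suc k)
    ≡⟨ ⊛-sucˡ (b ∧ₛ f) g k ⟩
  ((b ∧ f 0) ∧ g (suc k)) xor ((b ∧ₛ (f ∘ suc)) ⊛ g) k
    ≡⟨ ≡.cong (((b ∧ f 0) ∧ g (suc k)) xor_) (⊛-scalarˡ b (f ∘ suc) g k) ⟩
  ((b ∧ f 0) ∧ g (suc k)) xor (b ∧ ((f ∘ suc) ⊛ g) k)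
    ≡⟨ F₂.solve 4 (λ b x y z → (b :* x) :* y :+ b :* z := b :* (x :* y :+ z)) ≡.refl b (f 0) (g (suc k)) _ ⟩
  b ∧ ((f 0 ∧ g (suc k)) xor ((f ∘ suc) ⊛ g) k)
    ≡⟨ ≡.cong (b ∧_) (⊛-sucˡ f g k) ⟨
  b ∧ (f ⊛ g) (suc k) ∎
  where open ≡.≡-Reasoning

⊛-assoc : ∀ f g h → (f ⊛ g) ⊛ h ≐ f ⊛ (g ⊛ h)
⊛-assoc f g h zero    = Boolₚ.∧-assoc (f 0) (g 0) (h 0)
⊛-assoc f g h (suc k) = begin
  ((f ⊛ g) ⊛ h) (suc k)
    ≡⟨ ⊛-sucˡ (f ⊛ g) h k ⟩
  ((f 0 ∧ g 0) ∧ h (suc k)) xor (((f ⊛ g) ∘ suc) ⊛ h) k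
    ≡⟨ ≡.cong (((f 0 ∧ g 0) ∧ h (suc k)) xor_) (⊛-cong {g = h} (⊛-sucˡ f g) (λ _ → ≡.refl) k) ⟩
  ((f 0 ∧ g 0) ∧ h (suc k)) xor (((f 0 ∧ₛ (g ∘ suc)) ⊕ ((f ∘ suc) ⊛ g)) ⊛ h) k
    ≡⟨ ≡.cong (((f 0 ∧ g 0) ∧ h (suc k)) xor_) (⊛-distribʳ-⊕ (f 0 ∧ₛ (g ∘ suc)) ((f ∘ suc) ⊛ g) h k) ⟩
  ((f 0 ∧ g 0) ∧ h (suc k)) xor (((f 0 ∧ₛ (g ∘ suc)) ⊛ h) k xor (((f ∘ suc) ⊛ g) ⊛ h) k)
    ≡⟨ ≡.cong₂ (λ x y → ((f 0 ∧ g 0) ∧ h (suc k)) xor (x xor y)) (⊛-scalarˡ (f 0) (g ∘ suc) h k) (⊛-assoc (f ∘ suc) g h k) ⟩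
  ((f 0 ∧ g 0) ∧ h (suc k)) xor ((f 0 ∧ ((g ∘ suc) ⊛ h) k) xor ((f ∘ suc) ⊛ (g ⊛ h)) k)
    ≡⟨ F₂.solve 5 (λ a b c x y → (a :* b) :* c :+ (a :* x :+ y) := a :* (b :* c :+ x) :+ y) ≡.refl (f 0) (g 0) (h (suc k)) _ _ ⟩
  (f 0 ∧ ((g 0 ∧ h (suc k)) xor ((g ∘ suc) ⊛ h) k)) xor ((f ∘ suc) ⊛ (g ⊛ h)) k
    ≡⟨ ≡.cong (λ x → (f 0 ∧ x) xor ((f ∘ suc) ⊛ (g ⊛ h)) k) (⊛-sucˡ g h k) ⟨
  (f 0 ∧ (g ⊛ h) (suc k)) xor ((f ∘ suc) ⊛ (g ⊛ h)) k
    ≡⟨ ⊛-sucˡ f (g ⊛ h) k ⟨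
  (f ⊛ (g ⊛ h)) (suc k) ∎
  where open ≡.≡-Reasoning

Vanishes : ℕ → Series → Set
Vanishes k f = ∀ i → i < k → f i ≡ false

-- For `f = O(t^k)` every term of the Cauchy sum before the last is zero. This reads off the first
-- coefficient in which a perturbation can show.
⊛-vanishing : ∀ k f g → Vanishes k f → (f ⊛ g) k ≡ f k ∧ g 0
⊛-vanishing zero    f g v = ≡.refl
⊛-vanishing (suc k) f g v = ≡.trans (⊛-sucˡ f g k)
  (≡.trans (≡.cong (λ b → (b ∧ g (suc k)) xor ((f ∘ suc) ⊛ g) k) (v 0 (s≤s z≤n)))
           (⊛-vanishing k (f ∘ suc) g λ i i<k → v (suc i) (s≤s i<k)))

⊛-zeroˡ : ∀ f g → (∀ i → f i ≡ false) → ∀ k → (f ⊛ g) k ≡ false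
⊛-zeroˡ f g z k = ≡.trans (⊛-vanishing k f g λ i _ → z i) (≡.cong (_∧ g 0) (z k))

⊛-identityˡ : ∀ f → δ ⊛ f ≐ f
⊛-identityˡ f zero    = ≡.refl
⊛-identityˡ f (suc k) = ≡.trans (⊛-sucˡ δ f k)
  (≡.trans (≡.cong (f (suc k) xor_) (⊛-zeroˡ (δ ∘ suc) f (λ _ → ≡.refl) k)) (Boolₚ.xor-identityʳ _))

shift-⊛ : ∀ f g → shift f ⊛ g ≐ shift (f ⊛ g)
shift-⊛ f g zero    = ≡.refl
shift-⊛ f g (suc k) = ⊛-sucˡ (shift f) g k

shift-cong : ∀ {f g} → f ≐ g → shift f ≐ shift g
shift-cong eq zero    = ≡.refl
shift-cong eq (suc k) = eq k

shifts-⊛ : ∀ m f g → shifts m f ⊛ g ≐ shifts m (f ⊛ g)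
shifts-⊛ zero    f g k = ≡.refl
shifts-⊛ (suc m) f g k = ≡.trans (shift-⊛ (shifts m f) g k) (shift-cong (shifts-⊛ m f g) k)

shifts-+ : ∀ m f k → shifts m f (m ℕ.+ k) ≡ f k
shifts-+ zero    f k = ≡.refl
shifts-+ (suc m) f k = shifts-+ m f k

shifts-< : ∀ m f → Vanishes m (shifts m f)
shifts-< (suc m) f zero    _         = ≡.refl
shifts-< (suc m) f (suc i) (s≤s i<m) = shifts-< m f i i<m

-- The substitution t ↦ t^(suc m)

-- The same function as the one local to `scaleL`, given a name so that lemmas can refer to it.
stretch : ℕ → Series → Series
stretch m f k with k % suc m
... | zero  = f (k / suc m)
... | suc _ = false

coeff-scaleL : ∀ m f → coeff (scaleL m f) ≐ stretch m (coeff f)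
coeff-scaleL m f k with k % suc m
... | zero  = ≡.refl
... | suc _ = ≡.refl

stretch-< : ∀ m f k → suc k < suc m → stretch m f (suc k) ≡ false
stretch-< m f k k<m with suc k % suc m | DivMod.m<n⇒m%n≡m k<m
... | .(suc k) | ≡.refl = ≡.refl

stretch-+ : ∀ m f k → stretch m f (suc m ℕ.+ k) ≡ stretch m (f ∘ suc) k
stretch-+ m f k with (suc m ℕ.+ k) % suc m | ≡.trans (≡.cong (_% suc m) (ℕₚ.+-comm (suc m) k)) (DivMod.[m+n]%n≡m%n k (suc m))
... | _ | ≡.refl with k % suc m
...   | suc _ = ≡.refl
...   | zero  = ≡.cong f (≡.trans (DivMod.m/n≡1+[m∸n]/n (ℕₚ.m≤m+n (suc m) k))
                    (≡.cong (λ j → suc (j / suc m)) (ℕₚ.m+n∸m≡n (suc m) k)))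

stretch-cong : ∀ m {f g} → f ≐ g → stretch m f ≐ stretch m g
stretch-cong m f≐g k with k % suc m
... | zero  = f≐g (k / suc m)
... | suc _ = ≡.refl

-- A view of exponents by blocks of length `suc m`, so that proofs about `stretch` advance one block
-- at a time instead of computing with quotients and remainders.
data Position (m : ℕ) : ℕ → Set where
  start  : Position m 0
  middle : ∀ {k} → suc k < suc m → Position m (suc k)
  later  : ∀ j → Position m (suc m ℕ.+ j)

position : ∀ m k → Position m k
position m zero    = start
position m (suc k) with suc k ℕ.<? suc m
... | yes k<m = middle k<m
... | no  k≮m = ≡.subst (Position m) (ℕₚ.m+[n∸m]≡n (ℕₚ.≮⇒≥ k≮m)) (later (k ∸ m))

≐-by-position : ∀ m f g → f 0 ≡ g 0 →
                (∀ k → suc k < suc m → f (suc k) ≡ g (suc k)) →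
                (∀ j → f (suc m ℕ.+ j) ≡ g (suc m ℕ.+ j)) → f ≐ g
≐-by-position m f g f0 f< f+ k with position m k
... | start      = f0
... | middle k<m = f< _ k<m
... | later j    = f+ j

-- This is `f = f 0 + t · (f ∘ suc)` after substituting `t^(suc m)` for `t`.
stretch-decompose : ∀ m f → stretch m f ≐ (f 0 ∧ₛ δ) ⊕ shifts (suc m) (stretch m (f ∘ suc))
stretch-decompose m f = ≐-by-position m _ _
  (F₂.solve 1 (λ a → a := a :* con true :+ con false) ≡.refl (f 0))
  (λ k k<m → begin
    stretch m f (suc k)  ≡⟨ stretch-< m f k k<m ⟩
    false                ≡⟨ F₂.solve 1 (λ a → con false := a :* con false :+ con false) ≡.refl (f 0) ⟩
    (f 0 ∧ false) xor false ≡⟨ ≡.cong ((f 0 ∧ false) xor_) (shifts-< (suc m) _ (suc k) k<m) ⟨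
    ((f 0 ∧ₛ δ) ⊕ shifts (suc m) (stretch m (f ∘ suc))) (suc k) ∎)
  (λ j → begin
    stretch m f (suc m ℕ.+ j)  ≡⟨ stretch-+ m f j ⟩
    stretch m (f ∘ suc) j      ≡⟨ F₂.solve 2 (λ a b → b := a :* con false :+ b) ≡.refl (f 0) _ ⟩
    (f 0 ∧ false) xor stretch m (f ∘ suc) j ≡⟨ ≡.cong ((f 0 ∧ false) xor_) (shifts-+ (suc m) _ j) ⟨
    ((f 0 ∧ₛ δ) ⊕ shifts (suc m) (stretch m (f ∘ suc))) (suc m ℕ.+ j) ∎)
  where open ≡.≡-Reasoning

stretch-δ : ∀ m → stretch m δ ≐ δ
stretch-δ m = ≐-by-position m _ _ ≡.refl (stretch-< m δ)
  (λ j → ≡.trans (stretch-+ m δ j) (stretch-false j))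
  where
  stretch-false : ∀ j → stretch m (λ _ → false) j ≡ false
  stretch-false j with j % suc m
  ... | zero  = ≡.refl
  ... | suc _ = ≡.refl

stretch-true : ∀ m f k → stretch m f k ≡ true → ∃ λ j → k ≡ j ℕ.* suc m × f j ≡ true
stretch-true m f k eq with k % suc m in k%m
... | zero = k / suc m , ≡.trans (DivMod.m≡m%n+[m/n]*n k (suc m)) (≡.cong (ℕ._+ k / suc m ℕ.* suc m) k%m) , eq

stretch-* : ∀ m f j → stretch m f (suc m ℕ.* j) ≡ f j
stretch-* m f zero    = ≡.cong (stretch m f) (ℕₚ.*-zeroʳ (suc m))
stretch-* m f (suc j) = begin
  stretch m f (suc m ℕ.* suc j)        ≡⟨ ≡.cong (stretch m f) (ℕₚ.*-suc (suc m) j) ⟩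
  stretch m f (suc m ℕ.+ suc m ℕ.* j)  ≡⟨ stretch-+ m f (suc m ℕ.* j) ⟩
  stretch m (f ∘ suc) (suc m ℕ.* j)    ≡⟨ stretch-* m (f ∘ suc) j ⟩
  f (suc j)                            ∎
  where open ≡.≡-Reasoning

⊛-decompose : ∀ m b f g k → (((b ∧ₛ δ) ⊕ shifts m f) ⊛ g) k ≡ (b ∧ g k) xor shifts m (f ⊛ g) k
⊛-decompose m b f g k = begin
  (((b ∧ₛ δ) ⊕ shifts m f) ⊛ g) k              ≡⟨ ⊛-distribʳ-⊕ (b ∧ₛ δ) (shifts m f) g k ⟩
  ((b ∧ₛ δ) ⊛ g) k xor (shifts m f ⊛ g) k      ≡⟨ ≡.cong₂ _xor_ (⊛-scalarˡ b δ g k) (shifts-⊛ m f g k) ⟩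
  (b ∧ (δ ⊛ g) k) xor shifts m (f ⊛ g) k       ≡⟨ ≡.cong (λ x → (b ∧ x) xor shifts m (f ⊛ g) k) (⊛-identityˡ g k) ⟩
  (b ∧ g k) xor shifts m (f ⊛ g) k             ∎
  where open ≡.≡-Reasoning

-- Splitting off the constant term of `f` matches `⊛-sucˡ` on the right-hand side and lowers the
-- exponent by a whole block, whence strong induction. The left factor changes to `f ∘ suc`, so the
-- induction hypothesis quantifies over the series.
stretch-⊛ : ∀ m f g → stretch m f ⊛ stretch m g ≐ stretch m (f ⊛ g)
stretch-⊛ m f g k = <-rec P step k f g
  where
  open ≡.≡-Reasoning
  P : ℕ → Set
  P k = ∀ f g → (stretch m f ⊛ stretch m g) k ≡ stretch m (f ⊛ g) k

  peel : ∀ f g k → (stretch m f ⊛ stretch m g) k ≡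
         (f 0 ∧ stretch m g k) xor shifts (suc m) (stretch m (f ∘ suc) ⊛ stretch m g) k
  peel f g k = ≡.trans (⊛-cong {g = stretch m g} (stretch-decompose m f) (λ _ → ≡.refl) k)
                       (⊛-decompose (suc m) (f 0) (stretch m (f ∘ suc)) (stretch m g) k)

  linear : ∀ b f g j → stretch m ((b ∧ₛ f) ⊕ g) j ≡ (b ∧ stretch m f j) xor stretch m g j
  linear b f g j with j % suc m
  ... | zero  = ≡.refl
  ... | suc _ = F₂.solve 1 (λ a → con false := a :* con false :+ con false) ≡.refl b

  step : ∀ k → (∀ {j} → j < k → P j) → P k
  step k rec f g with position m k
  ... | start = ≡.refl
  ... | middle {k} k<m = begin
    (stretch m f ⊛ stretch m g) (suc k)
      ≡⟨ peel f g (suc k) ⟩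
    (f 0 ∧ stretch m g (suc k)) xor shifts (suc m) (stretch m (f ∘ suc) ⊛ stretch m g) (suc k)
      ≡⟨ ≡.cong₂ (λ x y → (f 0 ∧ x) xor y) (stretch-< m g k k<m) (shifts-< (suc m) _ (suc k) k<m) ⟩
    (f 0 ∧ false) xor false
      ≡⟨ F₂.solve 1 (λ a → a :* con false :+ con false := con false) ≡.refl (f 0) ⟩
    false
      ≡⟨ stretch-< m (f ⊛ g) k k<m ⟨
    stretch m (f ⊛ g) (suc k) ∎
  ... | later j = begin
    (stretch m f ⊛ stretch m g) (suc m ℕ.+ j)
      ≡⟨ peel f g (suc m ℕ.+ j) ⟩
    (f 0 ∧ stretch m g (suc m ℕ.+ j)) xor shifts (suc m) (stretch m (f ∘ suc) ⊛ stretch m g) (suc m ℕ.+ j)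
      ≡⟨ ≡.cong₂ (λ x y → (f 0 ∧ x) xor y) (stretch-+ m g j) (shifts-+ (suc m) (stretch m (f ∘ suc) ⊛ stretch m g) j) ⟩
    (f 0 ∧ stretch m (g ∘ suc) j) xor (stretch m (f ∘ suc) ⊛ stretch m g) j
      ≡⟨ ≡.cong ((f 0 ∧ stretch m (g ∘ suc) j) xor_) (rec (ℕₚ.m<n+m j (s≤s z≤n)) (f ∘ suc) g) ⟩
    (f 0 ∧ stretch m (g ∘ suc) j) xor stretch m ((f ∘ suc) ⊛ g) j
      ≡⟨ linear (f 0) (g ∘ suc) ((f ∘ suc) ⊛ g) j ⟨
    stretch m ((f 0 ∧ₛ (g ∘ suc)) ⊕ ((f ∘ suc) ⊛ g)) j
      ≡⟨ stretch-cong m (⊛-sucˡ f g) j ⟨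
    stretch m ((f ⊛ g) ∘ suc) j
      ≡⟨ stretch-+ m (f ⊛ g) j ⟨
    stretch m (f ⊛ g) (suc m ℕ.+ j) ∎

-- The two ends of the Cauchy sum are the same product `f 0 ∧ f (suc (suc k))` and cancel in
-- characteristic 2. What remains is the square of `f ∘ suc`, two exponents lower.
frobenius : ∀ f → f ⊛ f ≐ stretch 1 f
frobenius f zero          = Boolₚ.∧-idem (f 0)
frobenius f (suc zero)    = F₂.solve 2 (λ a b → a :* b :+ b :* a := con false) ≡.refl (f 0) (f 1)
frobenius f (suc (suc k)) = begin
  (f ⊛ f) (suc (suc k))
    ≡⟨ ⊛-sucˡ f f (suc k) ⟩
  (f 0 ∧ f (suc (suc k))) xor ((f ∘ suc) ⊛ f) (suc k)
    ≡⟨ ≡.cong ((f 0 ∧ f (suc (suc k))) xor_) (⊛-sucʳ (f ∘ suc) f k) ⟩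
  (f 0 ∧ f (suc (suc k))) xor (((f ∘ suc) ⊛ (f ∘ suc)) k xor (f (suc (suc k)) ∧ f 0))
    ≡⟨ F₂.solve 3 (λ a b c → a :* b :+ (c :+ b :* a) := c) ≡.refl (f 0) (f (suc (suc k))) _ ⟩
  ((f ∘ suc) ⊛ (f ∘ suc)) k
    ≡⟨ frobenius (f ∘ suc) k ⟩
  stretch 1 (f ∘ suc) k
    ≡⟨ stretch-+ 1 f k ⟨
  stretch 1 f (suc (suc k)) ∎
  where open ≡.≡-Reasoning

-- Odd roots of one-units

infixr 8 _^ₛ_

_^ₛ_ : Series → ℕ → Series
f ^ₛ zero  = δ
f ^ₛ suc n = f ⊛ f ^ₛ n

^ₛ-zero : ∀ f n → f 0 ≡ true → (f ^ₛ n) 0 ≡ true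
^ₛ-zero f zero    f0 = ≡.refl
^ₛ-zero f (suc n) f0 = ≡.cong₂ _∧_ f0 (^ₛ-zero f n f0)

stretch-^ₛ : ∀ m f n → stretch m f ^ₛ n ≐ stretch m (f ^ₛ n)
stretch-^ₛ m f zero    k = ≡.sym (stretch-δ m k)
stretch-^ₛ m f (suc n) k = ≡.trans (⊛-cong {f = stretch m f} (λ _ → ≡.refl) (stretch-^ₛ m f n) k) (stretch-⊛ m f (f ^ₛ n) k)

stretch-^ₛ-≐ : ∀ m {f g} n → g ^ₛ n ≐ f → stretch m g ^ₛ n ≐ stretch m f
stretch-^ₛ-≐ m {f} {g} n eq k = ≡.trans (stretch-^ₛ m g n k) (stretch-cong m eq k)

-- If g′ = g + e with e = O(t^k) then g′ⁿ = gⁿ + n e + O(t^(k+1)).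
^ₛ-perturb : ∀ n k g g′ → g 0 ≡ true → g′ 0 ≡ true → Vanishes k (g′ ⊕ g) →
             (g′ ^ₛ n ⊕ g ^ₛ n) k ≡ odd n ∧ (g′ ⊕ g) k
^ₛ-perturb zero    k g g′ g0 g′0 v = Boolₚ.xor-same (δ k)
^ₛ-perturb (suc n) k g g′ g0 g′0 v = begin
  (g′ ⊛ p′) k xor (g ⊛ p) k
    -- Inserting `g ⊛ p′` twice gives `g′p′ - gp = (g′ - g)p′ + g(p′ - p)`, where signs do not
    -- matter.
    ≡⟨ F₂.solve 3 (λ a b c → a :+ b := (a :+ c) :+ (c :+ b)) ≡.refl ((g′ ⊛ p′) k) ((g ⊛ p) k) ((g ⊛ p′) k) ⟩
  ((g′ ⊛ p′) k xor (g ⊛ p′) k) xor ((g ⊛ p′) k xor (g ⊛ p) k)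
    ≡⟨ ≡.cong₂ _xor_ (⊛-distribʳ-⊕ g′ g p′ k) (⊛-distribˡ-⊕ g p′ p k) ⟨
  ((g′ ⊕ g) ⊛ p′) k xor (g ⊛ (p′ ⊕ p)) k
    ≡⟨ ≡.cong₂ _xor_ (⊛-vanishing k (g′ ⊕ g) p′ v)
         (≡.trans (⊛-comm g (p′ ⊕ p) k) (⊛-vanishing k (p′ ⊕ p) g p-vanishes)) ⟩
  ((g′ ⊕ g) k ∧ p′ 0) xor ((p′ ⊕ p) k ∧ g 0)
    ≡⟨ ≡.cong₂ (λ x y → ((g′ ⊕ g) k ∧ x) xor ((p′ ⊕ p) k ∧ y)) (^ₛ-zero g′ n g′0) g0 ⟩
  ((g′ ⊕ g) k ∧ true) xor ((p′ ⊕ p) k ∧ true)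
    ≡⟨ ≡.cong (λ x → ((g′ ⊕ g) k ∧ true) xor (x ∧ true)) (^ₛ-perturb n k g g′ g0 g′0 v) ⟩
  ((g′ ⊕ g) k ∧ true) xor ((odd n ∧ (g′ ⊕ g) k) ∧ true)
    ≡⟨ F₂.solve 2 (λ e o → e :* con true :+ (o :* e) :* con true := (con true :+ o) :* e) ≡.refl ((g′ ⊕ g) k) (odd n) ⟩
  (true xor odd n) ∧ (g′ ⊕ g) k ∎
  where
  open ≡.≡-Reasoning
  p  = g ^ₛ n
  p′ = g′ ^ₛ n
  p-vanishes : Vanishes k (p′ ⊕ p)
  p-vanishes i i<k = ≡.trans
    (^ₛ-perturb n i g g′ g0 g′0 λ j j<i → v j (ℕₚ.<-trans j<i i<k))
    (≡.trans (≡.cong (odd n ∧_) (v i i<k)) (Boolₚ.∧-zeroʳ (odd n)))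

xor-false⇒≡ : ∀ x y → x xor y ≡ false → x ≡ y
xor-false⇒≡ true  true  _ = ≡.refl
xor-false⇒≡ false false _ = ≡.refl

-- Where `f` and `g` agree below `k`, their powers differ at `k` by `n` times the difference of `f`
-- and `g` there. As `n` is odd, equal powers force agreement at `k`.
^ₛ-injective : ∀ n f g → odd n ≡ true → f 0 ≡ true → g 0 ≡ true →
               f ^ₛ n ≐ g ^ₛ n → f ≐ g
^ₛ-injective n f g on f0 g0 eq k = xor-false⇒≡ _ _ (<-rec _ step k)
  where
  open ≡.≡-Reasoning
  step : ∀ k → (∀ {j} → j < k → (f ⊕ g) j ≡ false) → (f ⊕ g) k ≡ false
  step k rec = begin
    (f ⊕ g) k               ≡⟨ ≡.cong (_∧ (f ⊕ g) k) on ⟨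
    odd n ∧ (f ⊕ g) k       ≡⟨ ^ₛ-perturb n k g f g0 f0 (λ j j<k → rec j<k) ⟨
    (f ^ₛ n ⊕ g ^ₛ n) k     ≡⟨ ≡.cong (_xor (g ^ₛ n) k) (eq k) ⟩
    (g ^ₛ n ⊕ g ^ₛ n) k     ≡⟨ Boolₚ.xor-same ((g ^ₛ n) k) ⟩
    false                   ∎

module OddRoot (n : ℕ) (on : odd n ≡ true) (f : Series) (f0 : f 0 ≡ true) where
  open ≡.≡-Reasoning

  -- Stage `k` has the right `n`-th power up to `t^k`. Adding `b · t^(k+1)` changes the next
  -- coefficient of the power by `n · b = b`, so `b` is chosen as the defect there.
  approx : ℕ → Series
  approx zero    = δ
  approx (suc k) = approx k ⊕ shifts (suc k) (((f ⊕ approx k ^ₛ n) (suc k)) ∧ₛ δ)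

  -- The diagonal is the limit of the stages, because the coefficient at `k` no longer changes after
  -- stage `k`.
  root : Series
  root k = approx k k

  approx-zero : ∀ k → approx k 0 ≡ true
  approx-zero zero    = ≡.refl
  approx-zero (suc k) = ≡.trans (Boolₚ.xor-identityʳ _) (approx-zero k)

  approx-stable : ∀ i j → approx (j ℕ.+ i) i ≡ root i
  approx-stable i zero    = ≡.refl
  approx-stable i (suc j) = begin
    approx (j ℕ.+ i) i xor shifts (suc (j ℕ.+ i)) _ i ≡⟨ ≡.cong (approx (j ℕ.+ i) i xor_) (shifts-< (suc (j ℕ.+ i)) _ i (s≤s (ℕₚ.m≤n+m i j))) ⟩
    approx (j ℕ.+ i) i xor false                      ≡⟨ Boolₚ.xor-identityʳ _ ⟩
    approx (j ℕ.+ i) i                                ≡⟨ approx-stable i j ⟩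
    root i                                            ∎

  approx-vanishes : ∀ k → Vanishes (suc k) (root ⊕ approx k)
  approx-vanishes k i (s≤s i≤k) = begin
    root i xor approx k i               ≡⟨ ≡.cong (λ j → root i xor approx j i) (ℕₚ.m∸n+n≡m i≤k) ⟨
    root i xor approx (k ∸ i ℕ.+ i) i   ≡⟨ ≡.cong (root i xor_) (approx-stable i (k ∸ i)) ⟩
    root i xor root i                   ≡⟨ Boolₚ.xor-same (root i) ⟩
    false                               ∎

  correction : ∀ k b → shifts k (b ∧ₛ δ) k ≡ b
  correction zero    b = Boolₚ.∧-identityʳ b
  correction (suc k) b = correction k b

  -- At exponent `suc k` the root is compared with stage `k`, with which it agrees through exponent
  -- `k`. Their difference at `suc k` is exactly the correction added next, and this repairs the
  -- defect.
  root-^ₛ : root ^ₛ n ≐ f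
  root-^ₛ zero    = ≡.trans (^ₛ-zero root n ≡.refl) (≡.sym f0)
  root-^ₛ (suc k) = begin
    (root ^ₛ n) (suc k)
      ≡⟨ F₂.solve 2 (λ a b → a := (a :+ b) :+ b) ≡.refl _ ((approx k ^ₛ n) (suc k)) ⟩
    (root ^ₛ n ⊕ approx k ^ₛ n) (suc k) xor (approx k ^ₛ n) (suc k)
      ≡⟨ ≡.cong (_xor (approx k ^ₛ n) (suc k)) (^ₛ-perturb n (suc k) (approx k) root (approx-zero k) ≡.refl (approx-vanishes k)) ⟩
    (odd n ∧ (root ⊕ approx k) (suc k)) xor (approx k ^ₛ n) (suc k)
      ≡⟨ ≡.cong₂ (λ x y → (x ∧ ((approx k (suc k) xor y) xor approx k (suc k))) xor (approx k ^ₛ n) (suc k)) on (correction (suc k) _) ⟩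
    ((approx k (suc k) xor (f (suc k) xor (approx k ^ₛ n) (suc k))) xor approx k (suc k)) xor (approx k ^ₛ n) (suc k)
      ≡⟨ F₂.solve 3 (λ a f p → ((a :+ (f :+ p)) :+ a) :+ p := f) ≡.refl (approx k (suc k)) (f (suc k)) ((approx k ^ₛ n) (suc k)) ⟩
    f (suc k) ∎

-- Laurent series

infix 4 _≈L_

_≈L_ : Laurent → Laurent → Set
f ≈L g = ∀ e → coefAt f e ≡ coefAt g e

≈L-trans : ∀ {f g h} → f ≈L g → g ≈L h → f ≈L h
≈L-trans p q e = ≡.trans (p e) (q e)

-- Takes the case split out of `coefAt`, so that the shifted exponent becomes an argument that
-- equations can rewrite.
extend : Series → ℤ → Bool
extend c (+ k)    = c k
extend c -[1+ _ ] = false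

coefAt≡extend : ∀ f e → coefAt f e ≡ extend (coeff f) (e ℤ.- val f)
coefAt≡extend f e with e ℤ.- val f
... | + _      = ≡.refl
... | -[1+ _ ] = ≡.refl

extend-cong : ∀ {c c′} → c ≐ c′ → ∀ e → extend c e ≡ extend c′ e
extend-cong eq (+ k)    = eq k
extend-cong eq -[1+ _ ] = ≡.refl

coefAt-true : ∀ f e → coefAt f e ≡ true → ∃ λ k → e ≡ val f ℤ.+ + k × coeff f k ≡ true
coefAt-true f e eq with e ℤ.- val f in e-v
... | + k = k , ≡.trans (split e (val f)) (≡.cong (λ z → val f ℤ.+ z) e-v) , eq
  where
  split : ∀ e v → e ≡ v ℤ.+ (e ℤ.- v)
  split = solve-∀

coefAt-val+ : ∀ f k → coefAt f (val f ℤ.+ + k) ≡ coeff f k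
coefAt-val+ f k = ≡.trans (coefAt≡extend f (val f ℤ.+ + k)) (≡.cong (extend (coeff f)) (cancel (val f) (+ k)))
  where
  cancel : ∀ v k → v ℤ.+ k ℤ.- v ≡ k
  cancel = solve-∀

laurent-cong : ∀ {v w c c′} → v ≡ w → c ≐ c′ → laurent v c ≈L laurent w c′
laurent-cong {v} {c = c} {c′} ≡.refl eq e = begin
  coefAt (laurent v c) e   ≡⟨ coefAt≡extend _ e ⟩
  extend c (e ℤ.- v)       ≡⟨ extend-cong eq (e ℤ.- v) ⟩
  extend c′ (e ℤ.- v)      ≡⟨ coefAt≡extend _ e ⟨
  coefAt (laurent v c′) e  ∎
  where open ≡.≡-Reasoning

coeff-cong : ∀ {v w c c′} → v ≡ w → laurent v c ≈L laurent w c′ → c ≐ c′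
coeff-cong {v} {c = c} {c′} ≡.refl eq k = begin
  c k                                ≡⟨ coefAt-val+ (laurent v c) k ⟨
  coefAt (laurent v c) (v ℤ.+ + k)   ≡⟨ eq (v ℤ.+ + k) ⟩
  coefAt (laurent v c′) (v ℤ.+ + k)  ≡⟨ coefAt-val+ (laurent v c′) k ⟩
  c′ k                               ∎
  where open ≡.≡-Reasoning

-- Padding with `j` leading zeros leaves the series unchanged up to `_≈L_` and brings two series to
-- a common `val`, where `_≈L_` becomes equality of coefficients.
lower : ℕ → Laurent → Laurent
lower j f = laurent (val f ℤ.- + j) (shifts j (coeff f))

extend-shift : ∀ c e → extend (shift c) (ℤ.suc e) ≡ extend c e
extend-shift c (+ k)          = ≡.refl
extend-shift c -[1+ zero ]    = ≡.refl
extend-shift c -[1+ suc k ]   = ≡.refl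

lower-≈L : ∀ j f → lower j f ≈L f
lower-≈L zero    f e = laurent-cong (ℤₚ.+-identityʳ (val f)) (λ _ → ≡.refl) e
lower-≈L (suc j) f e = begin
  coefAt (lower (suc j) f) e
    ≡⟨ coefAt≡extend (lower (suc j) f) e ⟩
  extend (shift (shifts j (coeff f))) (e ℤ.- (val f ℤ.- + suc j))
    ≡⟨ ≡.cong (extend (shift (shifts j (coeff f)))) (up e (val f) (+ j)) ⟩
  extend (shift (shifts j (coeff f))) (ℤ.suc (e ℤ.- (val f ℤ.- + j)))
    ≡⟨ extend-shift (shifts j (coeff f)) (e ℤ.- (val f ℤ.- + j)) ⟩
  extend (shifts j (coeff f)) (e ℤ.- (val f ℤ.- + j))
    ≡⟨ coefAt≡extend (lower j f) e ⟨
  coefAt (lower j f) e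
    ≡⟨ lower-≈L j f e ⟩
  coefAt f e ∎
  where
  open ≡.≡-Reasoning
  up : ∀ e v j → e ℤ.- (v ℤ.- (+ 1 ℤ.+ j)) ≡ + 1 ℤ.+ (e ℤ.- (v ℤ.- j))
  up = solve-∀

common-val : ∀ v w → ∃ λ i → ∃ λ j → v ℤ.- + i ≡ w ℤ.- + j
common-val v w with v ℤ.- w in v-w
... | + n      = n , 0 , ≡.trans (≡.cong (λ z → v ℤ.- z) (≡.sym v-w)) (lemma v w)
  where
  lemma : ∀ v w → v ℤ.- (v ℤ.- w) ≡ w ℤ.- + 0
  lemma = solve-∀
... | -[1+ n ] = 0 , suc n , ≡.trans (lemma v w) (≡.cong (λ z → w ℤ.+ z) v-w)
  where
  lemma : ∀ v w → v ℤ.- + 0 ≡ w ℤ.+ (v ℤ.- w)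
  lemma = solve-∀

*L-comm : ∀ f g → (f *L g) ≈L (g *L f)
*L-comm f g = laurent-cong (ℤₚ.+-comm (val f) (val g)) (⊛-comm (coeff f) (coeff g))

*L-assoc : ∀ f g h → ((f *L g) *L h) ≈L (f *L (g *L h))
*L-assoc f g h = laurent-cong (ℤₚ.+-assoc (val f) (val g) (val h)) (⊛-assoc (coeff f) (coeff g) (coeff h))

1L : Laurent
1L = laurent (+ 0) δ

*L-identityˡ : ∀ f → (1L *L f) ≈L f
*L-identityˡ f = laurent-cong (ℤₚ.+-identityˡ (val f)) (⊛-identityˡ (coeff f))

lower-*L : ∀ j f g → (lower j f *L g) ≈L (f *L g)
lower-*L j f g = ≈L-trans {g = lower j (f *L g)}
  (laurent-cong (swap (val f) (val g) (+ j)) (shifts-⊛ j (coeff f) (coeff g)))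
  (lower-≈L j (f *L g))
  where
  swap : ∀ v w j → v ℤ.- j ℤ.+ w ≡ v ℤ.+ w ℤ.- j
  swap = solve-∀

-- Both factors are padded to a common `val`; there their coefficients coincide, and padding passes
-- through the product.
*L-congʳ : ∀ {f f′} g → f ≈L f′ → (f *L g) ≈L (f′ *L g)
*L-congʳ {f} {f′} g f≈f′ with common-val (val f) (val f′)
... | i , j , eq = λ e → begin
  coefAt (f *L g) e           ≡⟨ lower-*L i f g e ⟨
  coefAt (lower i f *L g) e   ≡⟨ laurent-cong (≡.cong (ℤ._+ val g) eq) (⊛-cong {g = coeff g} (coeff-cong eq lowered) (λ _ → ≡.refl)) e ⟩
  coefAt (lower j f′ *L g) e  ≡⟨ lower-*L j f′ g e ⟩
  coefAt (f′ *L g) e          ∎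
  where
  open ≡.≡-Reasoning
  lowered : lower i f ≈L lower j f′
  lowered e = ≡.trans (lower-≈L i f e) (≡.trans (f≈f′ e) (≡.sym (lower-≈L j f′ e)))

*L-cong : ∀ {f f′ g g′} → f ≈L f′ → g ≈L g′ → (f *L g) ≈L (f′ *L g′)
*L-cong {f} {f′} {g} {g′} f≈f′ g≈g′ e = begin
  coefAt (f *L g) e    ≡⟨ *L-congʳ {f} {f′} g f≈f′ e ⟩
  coefAt (f′ *L g) e   ≡⟨ *L-comm f′ g e ⟩
  coefAt (g *L f′) e   ≡⟨ *L-congʳ {g} {g′} f′ g≈g′ e ⟩
  coefAt (g′ *L f′) e  ≡⟨ *L-comm g′ f′ e ⟩
  coefAt (f′ *L g′) e  ∎
  where open ≡.≡-Reasoning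

scaleL-*L : ∀ m f g → (scaleL m f *L scaleL m g) ≈L scaleL m (f *L g)
scaleL-*L m f g = laurent-cong (≡.sym (ℤₚ.*-distribˡ-+ (+ suc m) (val f) (val g)))
  (λ k → begin
    (coeff (scaleL m f) ⊛ coeff (scaleL m g)) k        ≡⟨ ⊛-cong (coeff-scaleL m f) (coeff-scaleL m g) k ⟩
    (stretch m (coeff f) ⊛ stretch m (coeff g)) k      ≡⟨ stretch-⊛ m (coeff f) (coeff g) k ⟩
    stretch m (coeff f ⊛ coeff g) k                    ≡⟨ coeff-scaleL m (f *L g) k ⟨
    coeff (scaleL m (f *L g)) k                        ∎)
  where open ≡.≡-Reasoning

scaleL-1L : ∀ m → scaleL m 1L ≈L 1L
scaleL-1L m = laurent-cong (ℤₚ.*-zeroʳ (+ suc m))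
  (λ k → ≡.trans (coeff-scaleL m 1L k) (stretch-δ m k))

scaleL-true : ∀ m f e → coefAt (scaleL m f) e ≡ true → ∃ λ j → e ≡ j ℤ.* + suc m
scaleL-true m f e eq with coefAt-true (scaleL m f) e eq
... | k , e≡ , ck with stretch-true m (coeff f) k (≡.trans (≡.sym (coeff-scaleL m f k)) ck)
...   | j , k≡ , _ = val f ℤ.+ + j , (begin
  e                                              ≡⟨ e≡ ⟩
  + suc m ℤ.* val f ℤ.+ + k                      ≡⟨ ≡.cong (λ k → + suc m ℤ.* val f ℤ.+ + k) k≡ ⟩
  + suc m ℤ.* val f ℤ.+ + (j ℕ.* suc m)          ≡⟨ ≡.cong (λ z → + suc m ℤ.* val f ℤ.+ z) (ℤₚ.pos-* j (suc m)) ⟩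
  + suc m ℤ.* val f ℤ.+ + j ℤ.* + suc m          ≡⟨ factor (+ suc m) (val f) (+ j) ⟩
  (val f ℤ.+ + j) ℤ.* + suc m                    ∎)
  where
  open ≡.≡-Reasoning
  factor : ∀ m v j → m ℤ.* v ℤ.+ j ℤ.* m ≡ (v ℤ.+ j) ℤ.* m
  factor = solve-∀

extend-stretch : ∀ m c e → extend (stretch m c) (+ suc m ℤ.* e) ≡ extend c e
extend-stretch m c (+ j)    = ≡.trans
  (≡.cong (extend (stretch m c)) (≡.sym (ℤₚ.pos-* (suc m) j))) (stretch-* m c j)
extend-stretch m c -[1+ j ] = ≡.refl

coefAt-scaleL : ∀ m f e → coefAt (scaleL m f) (+ suc m ℤ.* e) ≡ coefAt f e
coefAt-scaleL m f e = begin
  coefAt (scaleL m f) (+ suc m ℤ.* e)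
    ≡⟨ coefAt≡extend (scaleL m f) (+ suc m ℤ.* e) ⟩
  extend (coeff (scaleL m f)) (+ suc m ℤ.* e ℤ.- + suc m ℤ.* val f)
    ≡⟨ extend-cong (coeff-scaleL m f) (+ suc m ℤ.* e ℤ.- + suc m ℤ.* val f) ⟩
  extend (stretch m (coeff f)) (+ suc m ℤ.* e ℤ.- + suc m ℤ.* val f)
    ≡⟨ ≡.cong (extend (stretch m (coeff f))) (factor (+ suc m) e (val f)) ⟩
  extend (stretch m (coeff f)) (+ suc m ℤ.* (e ℤ.- val f))
    ≡⟨ extend-stretch m (coeff f) (e ℤ.- val f) ⟩
  extend (coeff f) (e ℤ.- val f)
    ≡⟨ coefAt≡extend f e ⟨
  coefAt f e ∎
  where
  open ≡.≡-Reasoning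
  factor : ∀ m e v → m ℤ.* e ℤ.- m ℤ.* v ≡ m ℤ.* (e ℤ.- v)
  factor = solve-∀

scaleL-injective : ∀ m {f g} → scaleL m f ≈L scaleL m g → f ≈L g
scaleL-injective m {f} {g} eq e =
  ≡.trans (≡.sym (coefAt-scaleL m f e)) (≡.trans (eq (+ suc m ℤ.* e)) (coefAt-scaleL m g e))

frobeniusL : ∀ f → (f *L f) ≈L scaleL 1 f
frobeniusL f = laurent-cong (double (val f))
  (λ k → ≡.trans (frobenius (coeff f) k) (≡.sym (coeff-scaleL 1 f k)))
  where
  double : ∀ v → v ℤ.+ v ≡ + 2 ℤ.* v
  double = solve-∀

infixr 8 _^L_

_^L_ : Laurent → ℕ → Laurent
f ^L n = laurent (+ n ℤ.* val f) (coeff f ^ₛ n)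

^L-suc : ∀ f n → (f *L (f ^L n)) ≈L f ^L suc n
^L-suc f n = laurent-cong (≡.sym (ℤₚ.suc-* (+ n) (val f))) (λ _ → ≡.refl)

-- Over F₂ a nonzero leading coefficient is 1, so a monomial times a one-unit is the normal form of
-- every nonzero series.
record Monic (f : Laurent) : Set where
  constructor monic
  field
    order     : ℤ
    unit      : Series
    unit-zero : unit 0 ≡ true
    ≈-monic   : f ≈L laurent order unit

-- The known position `k` of a nonzero coefficient bounds the number of leading zeros to strip,
-- which makes the search terminate.
normalise : ∀ k v c → c k ≡ true → Monic (laurent v c)
normalise k v c ck with c 0 in c0
normalise k       v c ck | true  = monic v c c0 (λ _ → ≡.refl)
normalise zero    v c ck | false with () ← ≡.trans (≡.sym ck) c0
normalise (suc k) v c ck | false with normalise k (v ℤ.+ + 1) (c ∘ suc) ck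
... | monic w u u0 eq = monic w u u0 λ e → begin
  coefAt (laurent v c) e                          ≡⟨ laurent-cong (raise v) shifted e ⟩
  coefAt (lower 1 (laurent (v ℤ.+ + 1) (c ∘ suc))) e ≡⟨ lower-≈L 1 (laurent (v ℤ.+ + 1) (c ∘ suc)) e ⟩
  coefAt (laurent (v ℤ.+ + 1) (c ∘ suc)) e          ≡⟨ eq e ⟩
  coefAt (laurent w u) e                          ∎
  where
  open ≡.≡-Reasoning
  raise : ∀ v → v ≡ v ℤ.+ + 1 ℤ.- + 1
  raise = solve-∀
  shifted : c ≐ shift (c ∘ suc)
  shifted zero    = c0
  shifted (suc k) = ≡.refl

-- The order is the least exponent with coefficient 1: each `val` bounds the support from below and
-- belongs to it.
monic-injective : ∀ {v w c c′} → c 0 ≡ true → c′ 0 ≡ true →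
                  laurent v c ≈L laurent w c′ → v ≡ w × c ≐ c′
monic-injective {v} {w} {c} {c′} c0 c′0 eq = v≡w , coeff-cong v≡w eq
  where
  leading : ∀ v c → c 0 ≡ true → coefAt (laurent v c) v ≡ true
  leading v c c0 = ≡.trans (≡.cong (coefAt (laurent v c)) (≡.sym (ℤₚ.+-identityʳ v)))
                           (≡.trans (coefAt-val+ (laurent v c) 0) c0)
  bound : ∀ f {e} → coefAt f e ≡ true → val f ℤ.≤ e
  bound f {e} ce with coefAt-true f e ce
  ... | k , e≡ , _ = ≡.subst (val f ℤ.≤_) (≡.sym e≡) (ℤₚ.i≤i+j (val f) (+ k))
  v≡w : v ≡ w
  v≡w = ℤₚ.≤-antisym (bound (laurent v c) (≡.trans (eq w) (leading w c′ c′0)))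
                     (bound (laurent w c′) (≡.trans (≡.sym (eq v)) (leading v c c0)))

-- Puiseux series

-- Built with the constructor so that its denominator computes; `e ℚ./ 1` is stuck for a variable
-- `e`.
ι : ℤ → ℚ
ι e = mkℚ e 0 (Coprimality.sym (Coprimality.1-coprimeTo ℤ.∣ e ∣))

/1≡ι : ∀ e → e ℚ./ 1 ≡ ι e
/1≡ι e = ℚₚ.↥p/↧p≡p (ι e)

ι-* : ∀ a b → ι a ℚ.* ι b ≡ ι (a ℤ.* b)
ι-* a b = /1≡ι (a ℤ.* b)

ι-inverseʳ : ∀ m → ι (+ suc m) ℚ.* (ℚ.1/ ι (+ suc m)) ≡ ℚ.1ℚ
ι-inverseʳ m = ℚₚ.*-inverseʳ (ι (+ suc m))

*ι-surjective : ∀ m r → (r ℚ.* (ℚ.1/ ι (+ suc m))) ℚ.* ι (+ suc m) ≡ r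
*ι-surjective m r = ≡.trans (ℚₚ.*-assoc r _ _)
  (≡.trans (≡.cong (r ℚ.*_) (ℚₚ.*-inverseˡ (ι (+ suc m)))) (ℚₚ.*-identityʳ r))

*ι-injective : ∀ m r s → r ℚ.* ι (+ suc m) ≡ s ℚ.* ι (+ suc m) → r ≡ s
*ι-injective m r s eq = ≡.trans (≡.sym (cancel r)) (≡.trans (≡.cong (ℚ._* ℚ.1/ ι (+ suc m)) eq) (cancel s))
  where
  cancel : ∀ r → r ℚ.* ι (+ suc m) ℚ.* (ℚ.1/ ι (+ suc m)) ≡ r
  cancel r = ≡.trans (ℚₚ.*-assoc r _ _)
    (≡.trans (≡.cong (r ℚ.*_) (ι-inverseʳ m)) (ℚₚ.*-identityʳ r))

coefR : Laurent → ℚ → Bool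
coefR f r with ℚ.denominator-1 r
... | zero  = coefAt f (ℚ.numerator r)
... | suc _ = false

coefQ≡coefR : ∀ d f q → coefQ (puiseux d f) q ≡ coefR f (q ℚ.* ι (+ suc d))
coefQ≡coefR d f q = ≡.trans unfold (≡.cong (λ s → coefR f (q ℚ.* s)) (/1≡ι (+ suc d)))
  where
  unfold : coefQ (puiseux d f) q ≡ coefR f (q ℚ.* (+ suc d ℚ./ 1))
  unfold with ℚ.denominator-1 (q ℚ.* (+ suc d ℚ./ 1))
  ... | zero  = ≡.refl
  ... | suc _ = ≡.refl

coefR-cong : ∀ {f g} → f ≈L g → ∀ r → coefR f r ≡ coefR g r
coefR-cong eq (mkℚ e zero    _) = eq e
coefR-cong eq (mkℚ e (suc _) _) = ≡.refl

nonintegral : ∀ {k} r j → ℚ.denominator-1 r ≡ suc k → ¬ r ≡ ι j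
nonintegral r j () ≡.refl

-- The delicate case is an integral `s` with `r` not integral. A nonzero coefficient at `s` would
-- make `s` a multiple of `suc m`, and then `r` would be an integer. Keeping `s` as a variable with
-- an equation allows matching on its denominator.
coefR-scaleL : ∀ m f r s → r ℚ.* ι (+ suc m) ≡ s → coefR (scaleL m f) s ≡ coefR f r
coefR-scaleL m f (mkℚ e zero _) s eq = begin
  coefR (scaleL m f) s                      ≡⟨ ≡.cong (coefR (scaleL m f)) (≡.trans (≡.sym eq) (ι-* e (+ suc m))) ⟩
  coefAt (scaleL m f) (e ℤ.* + suc m)       ≡⟨ ≡.cong (coefAt (scaleL m f)) (ℤₚ.*-comm e (+ suc m)) ⟩
  coefAt (scaleL m f) (+ suc m ℤ.* e)       ≡⟨ coefAt-scaleL m f e ⟩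
  coefAt f e                                ∎
  where open ≡.≡-Reasoning
coefR-scaleL m f (mkℚ _ (suc _) _) (mkℚ e (suc _) _) eq = ≡.refl
coefR-scaleL m f r@(mkℚ _ (suc _) _) (mkℚ e zero _) eq = Boolₚ.¬-not integral
  where
  integral : ¬ coefAt (scaleL m f) e ≡ true
  integral ce =
    let j , e≡ = scaleL-true m f e ce
    in nonintegral r j ≡.refl (*ι-injective m r (ι j) (≡.trans eq (≡.trans (≡.cong ι e≡) (≡.sym (ι-* j (+ suc m))))))

infix 4 _≃_

-- The definition of _≈_ unfolds to a Π-type from which its arguments cannot be inferred.
record _≃_ (a b : L0) : Set where
  constructor wrap
  field unwrap : a ≈ b
open _≃_

≃-setoid : Setoid 0ℓ 0ℓ
≃-setoid = record
  { Carrier       = L0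
  ; _≈_           = _≃_
  ; isEquivalence = record
    { refl  = wrap λ _ → ≡.refl
    ; sym   = λ p → wrap λ q → ≡.sym (unwrap p q)
    ; trans = λ p r → wrap λ q → ≡.trans (unwrap p q) (unwrap r q)
    }
  }

open Setoid ≃-setoid using () renaming (refl to ≃-refl; sym to ≃-sym; trans to ≃-trans)

puiseux-cong : ∀ d {f g} → f ≈L g → puiseux d f ≃ puiseux d g
puiseux-cong d {f} {g} eq = wrap λ q → ≡.trans (coefQ≡coefR d f q)
  (≡.trans (coefR-cong eq (q ℚ.* ι (+ suc d))) (≡.sym (coefQ≡coefR d g q)))

puiseux-injective : ∀ d {f g} → puiseux d f ≃ puiseux d g → f ≈L g
puiseux-injective d {f} {g} eq e = ≡.trans (≡.sym (at f)) (≡.trans (unwrap eq q) (at g))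
  where
  q = ι e ℚ.* (ℚ.1/ ι (+ suc d))
  at : ∀ f → coefQ (puiseux d f) q ≡ coefAt f e
  at f = ≡.trans (coefQ≡coefR d f q) (≡.cong (coefR f) (*ι-surjective d (ι e)))

-- Expresses that `x^(1/n)` is the `m`-th power of `x^(1/(nm))`. The new denominator is given by an
-- equation, so that either order of the factors can be used.
rescale : ∀ {d m D} f → suc D ≡ suc d ℕ.* suc m → puiseux d f ≃ puiseux D (scaleL m f)
rescale {d} {m} {D} f D≡ = wrap λ q → begin
  coefQ (puiseux d f) q                                      ≡⟨ coefQ≡coefR d f q ⟩
  coefR f (q ℚ.* ι (+ suc d))                                ≡⟨ coefR-scaleL m f (q ℚ.* ι (+ suc d)) _ ≡.refl ⟨
  coefR (scaleL m f) (q ℚ.* ι (+ suc d) ℚ.* ι (+ suc m))     ≡⟨ ≡.cong (coefR (scaleL m f)) (ℚₚ.*-assoc q (ι (+ suc d)) (ι (+ suc m))) ⟩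
  coefR (scaleL m f) (q ℚ.* (ι (+ suc d) ℚ.* ι (+ suc m)))   ≡⟨ ≡.cong (λ s → coefR (scaleL m f) (q ℚ.* s)) product ⟩
  coefR (scaleL m f) (q ℚ.* ι (+ suc D))                     ≡⟨ coefQ≡coefR D (scaleL m f) q ⟨
  coefQ (puiseux D (scaleL m f)) q                           ∎
  where
  open ≡.≡-Reasoning
  product : ι (+ suc d) ℚ.* ι (+ suc m) ≡ ι (+ suc D)
  product = ≡.trans (ι-* (+ suc d) (+ suc m))
    (≡.cong ι (≡.trans (≡.sym (ℤₚ.pos-* (suc d) (suc m))) (≡.cong +_ (≡.sym D≡))))

infixl 7 _⊗_

-- suc (d ⊗ m) = suc d * suc m
_⊗_ : ℕ → ℕ → ℕ
d ⊗ m = m ℕ.+ d ℕ.* suc m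

⊗-comm : ∀ d m → suc (d ⊗ m) ≡ suc m ℕ.* suc d
⊗-comm d m = ℕₚ.*-comm (suc d) (suc m)

-- A product may be computed over any denominator common to both factors. Over `N`, a multiple of
-- both this denominator and the one built into `_*_`, the two versions of each factor agree as
-- Laurent series, and scaling commutes with `_*L_`.
*-represent : ∀ {a b D f g} → a ≃ puiseux D f → b ≃ puiseux D g → (a * b) ≃ puiseux D (f *L g)
*-represent {puiseux d₁ f₁} {puiseux d₂ f₂} {D} {f} {g} a≈ b≈ = begin
  puiseux d₁₂ (scaleL d₂ f₁ *L scaleL d₁ f₂)
    ≈⟨ rescale _ ≡.refl ⟩
  puiseux N (scaleL D (scaleL d₂ f₁ *L scaleL d₁ f₂))
    ≈⟨ puiseux-cong N (scaleL-*L D (scaleL d₂ f₁) (scaleL d₁ f₂)) ⟨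
  puiseux N (scaleL D (scaleL d₂ f₁) *L scaleL D (scaleL d₁ f₂))
    ≈⟨ puiseux-cong N (*L-cong {scaleL D (scaleL d₂ f₁)} {scaleL d₁₂ f} {scaleL D (scaleL d₁ f₂)} {scaleL d₁₂ g}
           (over f₁ f a≈ ≡.refl) (over f₂ g b≈ (⊗-comm d₁ d₂))) ⟩
  puiseux N (scaleL d₁₂ f *L scaleL d₁₂ g)
    ≈⟨ puiseux-cong N (scaleL-*L d₁₂ f g) ⟩
  puiseux N (scaleL d₁₂ (f *L g))
    ≈⟨ rescale (f *L g) (⊗-comm d₁₂ D) ⟨
  puiseux D (f *L g) ∎
  where
  open SetoidReasoning ≃-setoid
  d₁₂ = d₁ ⊗ d₂
  N   = d₁₂ ⊗ D
  over : ∀ {d m} h k → puiseux d h ≃ puiseux D k → suc d₁₂ ≡ suc d ℕ.* suc m →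
         scaleL D (scaleL m h) ≈L scaleL d₁₂ k
  over {d} {m} h k h≈k eq = puiseux-injective N (begin
    puiseux N (scaleL D (scaleL m h))  ≈⟨ rescale (scaleL m h) ≡.refl ⟨
    puiseux d₁₂ (scaleL m h)           ≈⟨ rescale h eq ⟨
    puiseux d h                        ≈⟨ h≈k ⟩
    puiseux D k                        ≈⟨ rescale k (⊗-comm d₁₂ D) ⟩
    puiseux N (scaleL d₁₂ k)           ∎)

one≃1L : ∀ D → one ≃ puiseux D 1L
one≃1L D = begin
  one                      ≈⟨ puiseux-cong 0 (laurent-cong ≡.refl λ { zero → ≡.refl ; (suc _) → ≡.refl }) ⟩
  puiseux 0 1L             ≈⟨ rescale 1L (≡.sym (ℕₚ.*-identityˡ (suc D))) ⟩
  puiseux D (scaleL D 1L)  ≈⟨ puiseux-cong D (scaleL-1L D) ⟩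
  puiseux D 1L             ∎
  where open SetoidReasoning ≃-setoid

common₂ : ∀ a b → ∃ λ D → ∃ λ f → ∃ λ g → a ≃ puiseux D f × b ≃ puiseux D g
common₂ (puiseux d₁ f) (puiseux d₂ g) =
  d₁ ⊗ d₂ , scaleL d₂ f , scaleL d₁ g , rescale f ≡.refl , rescale g (⊗-comm d₁ d₂)

common₃ : ∀ a b c → ∃ λ D → ∃ λ f → ∃ λ g → ∃ λ h →
          a ≃ puiseux D f × b ≃ puiseux D g × c ≃ puiseux D h
common₃ a b (puiseux d h) = let D , f , g , a≈ , b≈ = common₂ a b in
  D ⊗ d , scaleL d f , scaleL d g , scaleL D h ,
  ≃-trans a≈ (rescale f ≡.refl) , ≃-trans b≈ (rescale g ≡.refl) , rescale h (⊗-comm D d)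

*-cong : ∀ {a a′ b b′} → a ≃ a′ → b ≃ b′ → (a * b) ≃ (a′ * b′)
*-cong {a} {a′} {b} {b′} a≈a′ b≈b′ = let D , f , g , a′≈ , b′≈ = common₂ a′ b′ in begin
  a * b               ≈⟨ *-represent (≃-trans a≈a′ a′≈) (≃-trans b≈b′ b′≈) ⟩
  puiseux D (f *L g)  ≈⟨ *-represent a′≈ b′≈ ⟨
  a′ * b′             ∎
  where open SetoidReasoning ≃-setoid

*-comm : ∀ a b → (a * b) ≃ (b * a)
*-comm a b = let D , f , g , a≈ , b≈ = common₂ a b in begin
  a * b               ≈⟨ *-represent a≈ b≈ ⟩
  puiseux D (f *L g)  ≈⟨ puiseux-cong D (*L-comm f g) ⟩
  puiseux D (g *L f)  ≈⟨ *-represent b≈ a≈ ⟨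
  b * a               ∎
  where open SetoidReasoning ≃-setoid

*-assoc : ∀ a b c → ((a * b) * c) ≃ (a * (b * c))
*-assoc a b c = let D , f , g , h , a≈ , b≈ , c≈ = common₃ a b c in begin
  (a * b) * c                ≈⟨ *-represent (*-represent a≈ b≈) c≈ ⟩
  puiseux D ((f *L g) *L h)  ≈⟨ puiseux-cong D (*L-assoc f g h) ⟩
  puiseux D (f *L (g *L h))  ≈⟨ *-represent a≈ (*-represent b≈ c≈) ⟨
  a * (b * c)                ∎
  where open SetoidReasoning ≃-setoid

*-identityˡ : ∀ a → (one * a) ≃ a
*-identityˡ a@(puiseux d f) = begin
  one * a              ≈⟨ *-represent {b = a} (one≃1L d) ≃-refl ⟩
  puiseux d (1L *L f)  ≈⟨ puiseux-cong d (*L-identityˡ f) ⟩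
  puiseux d f          ∎
  where open SetoidReasoning ≃-setoid

L0-commutativeMonoid : CommutativeMonoid 0ℓ 0ℓ
L0-commutativeMonoid = record
  { Carrier = L0
  ; _≈_     = _≃_
  ; _∙_     = _*_
  ; ε       = one
  ; isCommutativeMonoid = record
    { isMonoid = record
      { isSemigroup = record
        { isMagma = record
          { isEquivalence = Setoid.isEquivalence ≃-setoid
          ; ∙-cong        = *-cong
          }
        ; assoc = *-assoc
        }
      ; identity = *-identityˡ , λ a → ≃-trans (*-comm a one) (*-identityˡ a)
      }
    ; comm = *-comm
    }
  }

-- Powers and square roots of Puiseux series

open Mult L0-commutativeMonoid using () renaming (_×_ to _⊙_)

⊙-represent : ∀ {a D f} n → a ≃ puiseux D f → n ⊙ a ≃ puiseux D (f ^L n)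
⊙-represent {D = D}     zero    a≃ = one≃1L D
⊙-represent {a} {D} {f} (suc n) a≃ = begin
  a * (n ⊙ a)                ≈⟨ *-represent a≃ (⊙-represent n a≃) ⟩
  puiseux D (f *L (f ^L n))  ≈⟨ puiseux-cong D (^L-suc f n) ⟩
  puiseux D (f ^L suc n)     ∎
  where open SetoidReasoning ≃-setoid

2⊙≃square : ∀ a → 2 ⊙ a ≃ (a * a)
2⊙≃square a = *-cong (≃-refl {a}) (CommutativeMonoid.identityʳ L0-commutativeMonoid a)

square-root : ∀ a → Σ L0 λ y → 2 ⊙ y ≃ a
square-root a@(puiseux d f) = y , (begin
  2 ⊙ y                   ≈⟨ 2⊙≃square y ⟩
  y * y                   ≈⟨ *-represent {y} {y} ≃-refl ≃-refl ⟩
  puiseux D (f *L f)      ≈⟨ puiseux-cong D (frobeniusL f) ⟩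
  puiseux D (scaleL 1 f)  ≈⟨ rescale f ≡.refl ⟨
  puiseux d f             ∎)
  where
  open SetoidReasoning ≃-setoid
  D = d ⊗ 1
  y = puiseux D f

-- Over a common denominator squaring is `scaleL 1`, which is undone by reading the coefficients at
-- even exponents.
square-injective : ∀ a b → 2 ⊙ a ≃ 2 ⊙ b → a ≃ b
square-injective a b eq = let D , f , g , a≃ , b≃ = common₂ a b in
  ≃-trans a≃ (≃-trans (puiseux-cong D {f} {g} (reduce D f g a≃ b≃)) (≃-sym b≃))
  where
  open SetoidReasoning ≃-setoid
  reduce : ∀ D f g → a ≃ puiseux D f → b ≃ puiseux D g → f ≈L g
  reduce D f g a≃ b≃ = scaleL-injective 1 {f} {g} (puiseux-injective D (begin
    puiseux D (scaleL 1 f)  ≈⟨ puiseux-cong D (frobeniusL f) ⟨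
    puiseux D (f *L f)      ≈⟨ *-represent a≃ a≃ ⟨
    a * a                   ≈⟨ 2⊙≃square a ⟨
    2 ⊙ a                   ≈⟨ eq ⟩
    2 ⊙ b                   ≈⟨ 2⊙≃square b ⟩
    b * b                   ≈⟨ *-represent b≃ b≃ ⟩
    puiseux D (g *L g)      ≈⟨ puiseux-cong D (frobeniusL g) ⟩
    puiseux D (scaleL 1 g)  ∎))

-- Units

-- A coefficient of a product is a finite sum, so a nonzero coefficient of the
-- factor can be found by bounded search.
unit-monic : ∀ d f b → (puiseux d f * b) ≈ one → Monic f
unit-monic d f (puiseux d′ g) inverse =
  let k , _ , pk = coefAt-true (scaleL d′ f *L scaleL d g) (+ 0)
                     (puiseux-injective (d ⊗ d′) (≃-trans (wrap inverse) (one≃1L (d ⊗ d′))) (+ 0))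
      i , hi     = sumTo-true _ k pk
      j , _ , fj = stretch-true d′ (coeff f) i
                     (≡.trans (≡.sym (coeff-scaleL d′ f i)) (∧-trueˡ _ _ hi))
  in normalise j (val f) (coeff f) fj
  where
  ∧-trueˡ : ∀ x y → x ∧ y ≡ true → x ≡ true
  ∧-trueˡ true _ _ = ≡.refl

record MonicOver (D : ℕ) (a : L0) : Set where
  constructor monicOver
  field
    order     : ℤ
    unit      : Series
    unit-zero : unit 0 ≡ true
    ≃-monic   : a ≃ puiseux D (laurent order unit)

unit-monicOver : ∀ (u : Unit) → MonicOver (d (elt u)) (elt u)
unit-monicOver (puiseux d f , b , inverse) =
  let monic v c c0 eq = unit-monic d f b inverse in monicOver v c c0 (puiseux-cong d eq)

stretch-order : ∀ m v c → scaleL m (laurent v c) ≈L laurent (+ suc m ℤ.* v) (stretch m c)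
stretch-order m v c = laurent-cong ≡.refl (coeff-scaleL m (laurent v c))

monicOver-rescale : ∀ {a D D′} m → suc D′ ≡ suc D ℕ.* suc m → MonicOver D a → MonicOver D′ a
-- The proof `c0` carries over because `stretch m c 0` computes to `c 0`.
monicOver-rescale {D′ = D′} m D≡ (monicOver v c c0 a≃) = monicOver (+ suc m ℤ.* v) (stretch m c) c0
  (≃-trans a≃ (≃-trans (rescale (laurent v c) D≡) (puiseux-cong D′ (stretch-order m v c))))

-- Let `s` be the root of `t` of order `suc n`. The monomial `t^v` has the root `s^v`, so `v` stays
-- as it is over the larger denominator, while the root of the one-unit is a series in
-- `t = s^(suc n)` and has to be stretched.
odd-root : ∀ n → odd (suc n) ≡ true → (u : Unit) → Σ L0 λ y → suc n ⊙ y ≃ elt u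
odd-root n on u@(puiseux d _ , _) = let monicOver v c c0 a≃ = unit-monicOver u in
  puiseux D (laurent v (stretch n (OddRoot.root (suc n) on c c0))) ,
  ≃-trans (power v c c0) (≃-sym a≃)
  where
  open SetoidReasoning ≃-setoid
  D = d ⊗ n
  power : ∀ v c c0 → suc n ⊙ puiseux D (laurent v (stretch n (OddRoot.root (suc n) on c c0))) ≃
          puiseux d (laurent v c)
  power v c c0 = begin
    suc n ⊙ puiseux D (laurent v (stretch n root))                       ≈⟨ ⊙-represent (suc n) ≃-refl ⟩
    puiseux D (laurent (+ suc n ℤ.* v) (stretch n root ^ₛ suc n))        ≈⟨ puiseux-cong D (laurent-cong ≡.refl (stretch-^ₛ-≐ n (suc n) root-^ₛ)) ⟩
    puiseux D (laurent (+ suc n ℤ.* v) (stretch n c))                    ≈⟨ puiseux-cong D (stretch-order n v c) ⟨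
    puiseux D (scaleL n (laurent v c))                                   ≈⟨ rescale (laurent v c) ≡.refl ⟨
    puiseux d (laurent v c)                                              ∎
    where open OddRoot (suc n) on c c0

-- Over a common denominator the powers are again monic, so their orders and their one-units agree
-- separately. The orders are compared by cancelling in `ℤ`, the one-units by `^ₛ-injective`.
odd-injective : ∀ n → odd (suc n) ≡ true → (u v : Unit) →
                suc n ⊙ elt u ≃ suc n ⊙ elt v → elt u ≃ elt v
odd-injective n on u v eq =
  compare (monicOver-rescale (d (elt v)) ≡.refl (unit-monicOver u))
          (monicOver-rescale (d (elt u)) (⊗-comm (d (elt u)) (d (elt v))) (unit-monicOver v))
  where
  open SetoidReasoning ≃-setoid
  D = d (elt u) ⊗ d (elt v)
  compare : MonicOver D (elt u) → MonicOver D (elt v) → elt u ≃ elt v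
  compare (monicOver i f f0 u≃) (monicOver j g g0 v≃) = begin
    elt u                    ≈⟨ u≃ ⟩
    puiseux D (laurent i f)  ≈⟨ puiseux-cong D (laurent-cong i≡j f≐g) ⟩
    puiseux D (laurent j g)  ≈⟨ v≃ ⟨
    elt v                    ∎
    where
    powers : (+ suc n) ℤ.* i ≡ (+ suc n) ℤ.* j × f ^ₛ suc n ≐ g ^ₛ suc n
    powers = monic-injective (^ₛ-zero f (suc n) f0) (^ₛ-zero g (suc n) g0)
      (puiseux-injective D (begin
        puiseux D (laurent i f ^L suc n)  ≈⟨ ⊙-represent (suc n) u≃ ⟨
        suc n ⊙ elt u                     ≈⟨ eq ⟩
        suc n ⊙ elt v                     ≈⟨ ⊙-represent (suc n) v≃ ⟩
        puiseux D (laurent j g ^L suc n)  ∎))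
    i≡j : i ≡ j
    i≡j = ℤₚ.*-cancelˡ-≡ (+ suc n) i j (proj₁ powers)
    f≐g : f ≐ g
    f≐g = ^ₛ-injective (suc n) f g on f0 g0 (proj₂ powers)

-- The group of units and its divisibility

open CommutativeMonoid L0-commutativeMonoid using (commutativeSemigroup)
open CommutativeSemigroupProperties commutativeSemigroup using (interchange; x∙yz≈xy∙z; xy∙z≈xz∙y)

_∙ᵘ_ : Unit → Unit → Unit
(a , b , ab≈1) ∙ᵘ (a′ , b′ , a′b′≈1) = a * a′ , b * b′ , unwrap (begin
  (a * a′) * (b * b′)  ≈⟨ interchange a a′ b b′ ⟩
  (a * b) * (a′ * b′)  ≈⟨ *-cong (wrap ab≈1) (wrap a′b′≈1) ⟩
  one * one            ≈⟨ *-identityˡ one ⟩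
  one                  ∎)
  where open SetoidReasoning ≃-setoid

1ᵘ : Unit
1ᵘ = one , one , unwrap (*-identityˡ one)

_⁻¹ᵘ : Unit → Unit
(a , b , ab≈1) ⁻¹ᵘ = b , a , unwrap (≃-trans (*-comm b a) (wrap ab≈1))

-- Equality of units ignores the stored inverse, so this is the uniqueness of inverses in a
-- commutative monoid.
⁻¹ᵘ-cong : ∀ u v → elt u ≃ elt v → elt (u ⁻¹ᵘ) ≃ elt (v ⁻¹ᵘ)
⁻¹ᵘ-cong (a , b , ab≈1) (a′ , b′ , a′b′≈1) a≃a′ = begin
  b              ≈⟨ *-identityˡ b ⟨
  one * b        ≈⟨ *-cong (wrap a′b′≈1) ≃-refl ⟨
  (a′ * b′) * b  ≈⟨ *-cong (*-cong a≃a′ ≃-refl) ≃-refl ⟨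
  (a * b′) * b   ≈⟨ xy∙z≈xz∙y a b′ b ⟩
  (a * b) * b′   ≈⟨ *-cong (wrap ab≈1) ≃-refl ⟩
  one * b′       ≈⟨ *-identityˡ b′ ⟩
  b′             ∎
  where open SetoidReasoning ≃-setoid

units : AbelianGroup 0ℓ 0ℓ
units = record
  { Carrier = Unit
  ; _≈_     = λ u v → elt u ≃ elt v
  ; _∙_     = _∙ᵘ_
  ; ε       = 1ᵘ
  ; _⁻¹     = _⁻¹ᵘ
  ; isAbelianGroup = record
    { isGroup = record
      { isMonoid = record
        { isSemigroup = record
          { isMagma = record
            { isEquivalence = record { refl = ≃-refl ; sym = ≃-sym ; trans = ≃-trans }
            ; ∙-cong        = *-cong
            }
          ; assoc = λ u v w → *-assoc (elt u) (elt v) (elt w)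
          }
        ; identity = (λ u → *-identityˡ (elt u))
                   , (λ u → CommutativeMonoid.identityʳ L0-commutativeMonoid (elt u))
        }
      ; inverse = (λ u → wrap (proj₂ (proj₂ (u ⁻¹ᵘ)))) , (λ u → wrap (proj₂ (proj₂ u)))
      ; ⁻¹-cong = λ {u} {v} → ⁻¹ᵘ-cong u v
      }
    ; comm = λ u v → *-comm (elt u) (elt v)
    }
  }

open AbelianGroup units using () renaming (commutativeMonoid to unitsMonoid)
open Mult unitsMonoid using () renaming (_×_ to _⊙ᵘ_)
open Divisibility unitsMonoid

elt-⊙ : ∀ n u → elt (n ⊙ᵘ u) ≡ n ⊙ elt u
elt-⊙ zero    u = ≡.refl
elt-⊙ (suc n) u = ≡.cong (elt u *_) (elt-⊙ n u)

-- If `y^(n+1) = a` and `a b = 1`, then `y^n b` inverts `y`. Hence roots may be sought in `L0`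
-- alone.
root-unit : ∀ n u y → suc n ⊙ y ≃ elt u → Σ Unit λ w → elt (suc n ⊙ᵘ w) ≃ elt u
root-unit n (a , b , ab≈1) y power = w , ≡.subst (_≃ a) (≡.sym (elt-⊙ (suc n) w)) power
  where
  open SetoidReasoning ≃-setoid
  w : Unit
  w = y , (n ⊙ y) * b , unwrap (begin
    y * ((n ⊙ y) * b)  ≈⟨ x∙yz≈xy∙z y (n ⊙ y) b ⟩
    (suc n ⊙ y) * b    ≈⟨ *-cong power ≃-refl ⟩
    a * b              ≈⟨ wrap ab≈1 ⟩
    one                ∎)

units-divisible : ∀ n → UniquelyDivisibleBy (suc n)
units-divisible = divisible-all
  ( (λ u v eq → square-injective (elt u) (elt v) (≡.subst₂ _≃_ (elt-⊙ 2 u) (elt-⊙ 2 v) eq))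
  , (λ u → let y , power = square-root (elt u) in root-unit 1 u y power))
  -- The case of exponent 0 is excluded because `odd zero` is `false`.
  λ { (suc n) on →
      (λ u v eq → odd-injective n on u v (≡.subst₂ _≃_ (elt-⊙ (suc n) u) (elt-⊙ (suc n) v) eq))
    , (λ u → let y , power = odd-root n on u in root-unit n u y power) }

open UniquelyDivisible units units-divisible

theorem1p3 : QLinearSpace
theorem1p3 = record
  { _·_        = _•_
  ; ·-cong     = λ q u v eq → unwrap (•-cong q {u} {v} (wrap eq))
  -- The unit `w` may carry any inverse; congruence first replaces it by the product `u ∙ᵘ v`.
  ; ·-distˡ    = λ q u v w eq → unwrap (≃-trans (•-cong q {w} {u ∙ᵘ v} (wrap eq)) (•-distrib-∙ q u v))
  ; ·-distʳ    = λ p q u → unwrap (•-homo-+ p q u)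
  ; ·-assoc    = λ p q u → unwrap (•-homo-* p q u)
  ; ·-identity = λ u → unwrap (•-identity u)
  }
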